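{- Let $a\geq 4$ be an integer, let $\rho'$ be the root of $x^3-ax^2-(a+3)x-1$ with $-2<\rho'<-1$, and put $A_0=\lfloor a/2\rfloor$. Then the homogeneous Jacobi--Perron expansion of the vector $(1,-\rho',\rho'^2)$ is periodic. The preperiod is equal to \begin{align*} \boldsymbol{\beta}^{(0)}&=(1,-\rho',\rho'^2),\\ \boldsymbol{\beta}^{(1)}&=(-1-\rho',-1+\rho'^2,1). \end{align*} The period length is $7$. The iterations (2)--(4) are equal to \begin{align*} \boldsymbol{\beta}^{(2)}&=(1+2\rho'+\rho'^2,\ a+2+(a+1)\rho',\ -1-\rho'),\\ \boldsymbol{\beta}^{(3)}&=(a+1+(a-1)\rho'-\rho'^2,\ -(a+2)-(2a+3)\rho'-(a+1)\rho'^2,\ 1+2\rho'+\rho'^2),\\ \boldsymbol{\beta}^{(4)}&=(-(a+2)-(2a+3)\rho'-(a+1)\rho'^2,\ -a-(a-3)\rho'+2\rho'^2,\ a+1+(a-1)\rho'-\rho'^2). \end{align*} If $a$ is even, the iterations (5)--(7) are \begin{align*} \boldsymbol{\beta}^{(5)}&=(-a-(a-3)\rho'+2\rho'^2,\ 2A_0^2+4A_0+1+(4A_0^2+5A_0-1)\rho'+(2A_0^2+A_0-1)\rho'^2,\\&\qquad -(a+2)-(2a+3)\rho'-(a+1)\rho'^2),\\ \boldsymbol{\beta}^{(6)}&=(2A_0^2+4A_0+1+(4A_0^2+5A_0-1)\rho'+(2A_0^2+A_0-1)\rho'^2,\ a-2-9\rho'-(a+5)\rho'^2,\\&\qquad -a-(a-3)\rho'+2\rho'^2),\\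 \boldsymbol{\beta}^{(7)}&=(a-2-9\rho'-(a+5)\rho'^2,\ -2A_0^2-6A_0-1-(4A_0^2+7A_0-4)\rho'-(2A_0^2+A_0-3)\rho'^2,\\&\qquad 2A_0^2+4A_0+1+(4A_0^2+5A_0-1)\rho'+(2A_0^2+A_0-1)\rho'^2). \end{align*} If $a$ is odd, the iterations (5)--(7) are \begin{align*} \boldsymbol{\beta}^{(5)}&=(-a-(a-3)\rho'+2\rho'^2,\ 2A_0^2+5A_0+2+(4A_0^2+7A_0)\rho'+(2A_0^2+2A_0-1)\rho'^2,\\&\qquad -(a+2)-(2a+3)\rho'-(a+1)\rho'^2),\\ \boldsymbol{\beta}^{(6)}&=(2A_0^2+7A_0+3+(4A_0^2+9A_0-2)\rho'+(2A_0^2+2A_0-3)\rho'^2,\ a-2-9\rho'-(a+5)\rho'^2,\\&\qquad -a-(a-3)\rho'+2\rho'^2),\\ \boldsymbol{\beta}^{(7)}&=(a-2-9\rho'-(a+5)\rho'^2,\ -2A_0^2-9A_0-4-(4A_0^2+11A_0-4)\rho'-(2A_0^2+2A_0-5)\rho'^2,\\&\qquad 2A_0^2+7A_0+3+(4A_0^2+9A_0-2)\rho'+(2A_0^2+2A_0-3)\rho'^2). \end{align*} Finally, the iteration (8) is $$\boldsymbol{\beta}^{(8)}=(-a^2-5-(a^2-a+14)\rho'-7\rho'^2,\ 7+(a^2+7a+26)\rho'+(a^2+6a+14)\rho'^2,\ a-2-9\rho'-(a+5)\rho'^2).$$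
   Context: The (homogeneous) Jacobi--Perron expansion of $\boldsymbol{\beta}^{(0)}=(\beta_1^{(0)},\beta_2^{(0)},\beta_3^{(0)})\in\mathbb{R}^3$ is the sequence $\boldsymbol{\beta}^{(k)}$, $k\ge 0$, with $$\boldsymbol{\beta}^{(k+1)}=\left(\beta_2^{(k)}-b_2^{(k)}\beta_1^{(k)},\ \beta_3^{(k)}-b_3^{(k)}\beta_1^{(k)},\ \beta_1^{(k)}\right),\qquad b_i^{(k)}=\left\lfloor \beta_i^{(k)}/\beta_1^{(k)}\right\rfloor .$$ It is periodic if there exist integers $l_0\ge 0$, $l_1\ge 1$ and a unit $\varepsilon$ (of the ring of integers of the number field generated by the entries) such that $\beta_i^{(k+l_1)}=\varepsilon\beta_i^{(k)}$ for all $1\le i\le 3$ and $k\ge l_0$. For the smallest such $l_0,l_1$, the vectors $\boldsymbol{\beta}^{(0)},\dots,\boldsymbol{\beta}^{(l_0-1)}$ form the preperiod and $\boldsymbol{\beta}^{(l_0)},\dots,\boldsymbol{\beta}^{(l_0+l_1-1)}$ the period; $l_0$ and $l_1$ are their lengths. -}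

module Defs where

open import Agda.Builtin.FromNat public using (Number; fromNat)
open import Algebra.Apartness.Bundles using (HeytingCommutativeRing; HeytingField)
open import Algebra.Bundles using (CommutativeRing)
import Algebra.Properties.Monoid.Mult as Mult
open import Data.Integer.Base using (ℤ; +_; -[1+_])
import Data.Integer.Literals as ℤ-Literals
open import Data.List.Base using (List; []; _∷_)
open import Data.Nat.Base using (ℕ; suc)
import Data.Nat.Base as ℕ
import Data.Nat.Literals as ℕ-Literals
open import Data.Product.Base using (_×_; _,_; proj₁; proj₂; ∃-syntax)
open import Data.Sum.Base using (_⊎_)
-- The instance that discharges the trivial constraint on literals.
open import Data.Unit.Base public using (tt)
open import Function.Bundles using (_⇔_)
open import Level using (Level; _⊔_) renaming (suc to lsuc)
open import Relation.Binary.Core using (Rel)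
open import Relation.Binary.Structures using (IsStrictPartialOrder)
open import Relation.Nullary.Negation using (¬_)

instance
  ℕ-number : Number ℕ
  ℕ-number = ℕ-Literals.number

  ℤ-number : Number ℤ
  ℤ-number = ℤ-Literals.number

-- The real numbers, characterised as a Cauchy-complete Archimedean ordered
-- field.  The axioms are the constructively valid ones: `<` is only
-- cotransitive (through `#`) and inverses exist for elements apart from 0#.
-- Thus the Cauchy reals are a model without excluded middle, and with
-- excluded middle the model is unique up to isomorphism.
record Reals (c ℓ₁ ℓ₂ ℓ₃ : Level) : Set (lsuc (c ⊔ ℓ₁ ⊔ ℓ₂ ⊔ ℓ₃)) where
  infix 4 _<_ _≤_
  field
    heytingField : HeytingField c ℓ₁ ℓ₂

  open HeytingField heytingField public

  field
    _<_                  : Rel Carrier ℓ₃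
    isStrictPartialOrder : IsStrictPartialOrder _≈_ _<_
    #⇔<⊎>                : ∀ x y → x # y ⇔ (x < y ⊎ y < x)
    +-monoˡ-<            : ∀ z {x y} → x < y → x + z < y + z
    *-positive           : ∀ {x y} → 0# < x → 0# < y → 0# < x * y

  open HeytingCommutativeRing heytingCommutativeRing using (commutativeRing) public
  open CommutativeRing commutativeRing using (+-monoid)
  open Mult +-monoid using () renaming (_×_ to _·_)

  Cauchy : (ℕ → Carrier) → Set (c ⊔ ℓ₃)
  Cauchy s = ∀ ε → 0# < ε →
    ∃[ N ] (∀ m n → N ℕ.≤ m → N ℕ.≤ n → s m - s n < ε)

  ConvergesTo : (ℕ → Carrier) → Carrier → Set (c ⊔ ℓ₃)
  ConvergesTo s l = ∀ ε → 0# < ε →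
    ∃[ N ] (∀ n → N ℕ.≤ n → s n - l < ε × l - s n < ε)

  field
    archimedean : ∀ x → ∃[ n ] x < n · 1#
    complete    : ∀ s → Cauchy s → ∃[ l ] ConvergesTo s l

  _≤_ : Rel Carrier ℓ₃
  x ≤ y = ¬ (y < x)

  fromℤ : ℤ → Carrier
  fromℤ (+ n)    = n · 1#
  fromℤ -[1+ n ] = - (suc n · 1#)

module JacobiPerron {c ℓ₁ ℓ₂ ℓ₃ : Level} (ℝ : Reals c ℓ₁ ℓ₂ ℓ₃) where
  open Reals ℝ

  infix 4 _≋_
  infixr 7 _⊙_

  ℝ³ : Set c
  ℝ³ = Carrier × Carrier × Carrier

  _≋_ : Rel ℝ³ ℓ₁
  (x₁ , x₂ , x₃) ≋ (y₁ , y₂ , y₃) = x₁ ≈ y₁ × x₂ ≈ y₂ × x₃ ≈ y₃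

  _⊙_ : Carrier → ℝ³ → ℝ³
  ε ⊙ (x₁ , x₂ , x₃) = ε * x₁ , ε * x₂ , ε * x₃

  -- `#⇒invertible` inverts `x - 0#` rather than `x`; the two are `≈`.
  inv : (x : Carrier) → x # 0# → Carrier
  inv x x#0 = proj₁ (#⇒invertible x#0)

  IsFloor : Carrier → ℤ → Set ℓ₃
  IsFloor x n = fromℤ n ≤ x × x < fromℤ n + 1#

  -- A relation and not a function, since neither the floor of a real number
  -- nor the test for a non-zero first entry is computable.
  Step : Rel ℝ³ (ℓ₁ ⊔ ℓ₂ ⊔ ℓ₃)
  Step (β₁ , β₂ , β₃) β′ =
    ∃[ β₁#0 ] ∃[ b₂ ] ∃[ b₃ ]
      IsFloor (β₂ * inv β₁ β₁#0) b₂ ×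
      IsFloor (β₃ * inv β₁ β₁#0) b₃ ×
      β′ ≋ (β₂ - fromℤ b₂ * β₁ , β₃ - fromℤ b₃ * β₁ , β₁)

  IsExpansion : ℝ³ → (ℕ → ℝ³) → Set (ℓ₁ ⊔ ℓ₂ ⊔ ℓ₃)
  IsExpansion v β = β 0 ≋ v × (∀ k → Step (β k) (β (suc k)))

  -- The list c₀ ∷ … ∷ cₙ₋₁ ∷ [] stands for c₀ + c₁x + … + cₙ₋₁xⁿ⁻¹ + xⁿ.
  evalMonic : List ℤ → Carrier → Carrier
  evalMonic []       x = 1#
  evalMonic (c ∷ cs) x = fromℤ c + x * evalMonic cs x

  AlgebraicInteger : Carrier → Set ℓ₁
  AlgebraicInteger x = ∃[ cs ] evalMonic cs x ≈ 0#

  -- The subfield of the real numbers generated by the entries of a vector.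
  data ℚ⟨_⟩ (v : ℝ³) : Carrier → Set (c ⊔ ℓ₁ ⊔ ℓ₂) where
    entry₁ : ℚ⟨ v ⟩ (proj₁ v)
    entry₂ : ℚ⟨ v ⟩ (proj₁ (proj₂ v))
    entry₃ : ℚ⟨ v ⟩ (proj₂ (proj₂ v))
    one    : ℚ⟨ v ⟩ 1#
    add    : ∀ {x y} → ℚ⟨ v ⟩ x → ℚ⟨ v ⟩ y → ℚ⟨ v ⟩ (x + y)
    neg    : ∀ {x} → ℚ⟨ v ⟩ x → ℚ⟨ v ⟩ (- x)
    mul    : ∀ {x y} → ℚ⟨ v ⟩ x → ℚ⟨ v ⟩ y → ℚ⟨ v ⟩ (x * y)
    recip  : ∀ {x} (x#0 : x # 0#) → ℚ⟨ v ⟩ x → ℚ⟨ v ⟩ (inv x x#0)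
    resp   : ∀ {x y} → x ≈ y → ℚ⟨ v ⟩ x → ℚ⟨ v ⟩ y

  𝒪⟨_⟩ : ℝ³ → Carrier → Set (c ⊔ ℓ₁ ⊔ ℓ₂)
  𝒪⟨ v ⟩ x = ℚ⟨ v ⟩ x × AlgebraicInteger x

  Unit : ℝ³ → Carrier → Set (c ⊔ ℓ₁ ⊔ ℓ₂)
  Unit v ε = 𝒪⟨ v ⟩ ε × ∃[ η ] (𝒪⟨ v ⟩ η × ε * η ≈ 1#)

  IsPeriodic : (ℕ → ℝ³) → (l₀ l₁ : ℕ) → Set (c ⊔ ℓ₁ ⊔ ℓ₂)
  IsPeriodic β l₀ l₁ = 1 ℕ.≤ l₁ × ∃[ ε ]
    (Unit (β 0) ε × (∀ k → l₀ ℕ.≤ k → β (k ℕ.+ l₁) ≋ ε ⊙ β k))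

  PeriodicWithLengths : (ℕ → ℝ³) → (l₀ l₁ : ℕ) → Set (c ⊔ ℓ₁ ⊔ ℓ₂)
  PeriodicWithLengths β l₀ l₁ = IsPeriodic β l₀ l₁ ×
    (∀ m₀ m₁ → IsPeriodic β m₀ m₁ → l₀ ℕ.≤ m₀ × l₁ ℕ.≤ m₁)

  quadratic : Carrier → ℤ → ℤ → ℤ → Carrier
  quadratic x p q r = fromℤ p + fromℤ q * x + fromℤ r * (x * x)

{-# OPTIONS --safe #-}
-- With t = -1 - ρ, which is positive, the number s = 1/t is the positive root of the same cubic, so that
-- s³ = 1 + (a + 3) s + a s² and all entries of the iterations lie in ℤ[s].  Multiplication by s has a non-negative
-- matrix in the basis 1, s, s², so an element is shown to be positive by multiplying it with a power of s until its
-- coordinates are non-negative; writing a = 2 (m + 2) + δ with δ ∈ {0, 1}, a single exponent works uniformly in m.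
-- As floors are unique, these inequalities determine the expansion.  It closes up because (s + s²)² β⁽⁹⁾ = β⁽²⁾, where
-- s + s² is a unit.  The lengths are minimal because the third digit attains its maximum a + 2 exactly at the positions
-- 8, 15, 22, …: the length of a period is divisible by 7, and position 1 cannot belong to a period.

module Submission where

open import Defs
open import Algebra.Bundles using (CommutativeRing)
import Algebra.Properties.AbelianGroup as AbelianGroupProperties
import Algebra.Properties.Monoid.Mult as MonoidMult
import Algebra.Properties.Ring as RingProperties
import Algebra.Properties.Semiring.Mult as SemiringMult
import Algebra.Solver.Ring as RingSolver
open import Algebra.Solver.Ring.AlmostCommutativeRing using (_-Raw-AlmostCommutative⟶_; fromCommutativeRing)
open import Data.Bool.Base using (Bool; true; _∧_; T)
open import Data.Bool.Properties using (T?)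
open import Data.Empty using (⊥-elim)
open import Data.Fin.Base using (Fin; toℕ)
open import Data.Fin.Patterns using (0F; 1F; 2F; 3F; 4F; 5F; 6F; 7F; 8F)
open import Data.Fin.Properties using (all?)
open import Data.Integer.Base as ℤ using (ℤ; +_; -[1+_]; +≤+)
open import Data.Integer.Divisibility using (_∣_)
open import Data.Integer.DivMod using (_/ℕ_)
import Data.Integer.Properties as ℤ
open import Data.Integer.Solver using (module +-*-Solver)
open import Data.Integer.Tactic.RingSolver using (solve-∀)
open import Data.List.Base as List using (List; []; _∷_)
open import Data.Maybe.Base as Maybe using (Maybe)
open import Data.Nat.Base as ℕ using (ℕ; zero; suc; s≤s; z≤n)
import Data.Nat.Divisibility as ℕ
import Data.Nat.DivMod as ℕ
import Data.Nat.Properties as ℕ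
open import Data.Product.Base using (_×_; _,_; proj₁; proj₂; ∃-syntax)
open import Data.Sum.Base using (_⊎_; inj₂; [_,_]′)
import Data.Vec.Base as Vec
open import Function.Bundles using (Equivalence)
open import Level using (Level; _⊔_)
open import Relation.Binary.Definitions using (tri<; tri≈; tri>)
open import Relation.Binary.PropositionalEquality as ≡ using (_≡_; refl)
open import Relation.Binary.Structures using (IsStrictPartialOrder)
open import Relation.Nullary.Decidable using (dec⇒maybe; toWitness; ⌊_⌋)
open import Relation.Nullary.Negation using (¬_)

-- The map x ↦ -1/(1 + x) permutes the roots of the cubic f and sends ρ to s. Passing to this
-- conjugate is what makes signs visible: ρ is not dominant, so coefficients of mixed signs in 1, ρ,
-- ρ² cancel, whereas s, lying between a + 1 and a + 2, is the dominant root of f, and for large k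
-- the coordinates of sᵏ x all take the sign of x. The obstacle is that neither floors nor signs can
-- be decided for these reals. Each floor has to be certified by strict inequalities, valid for all
-- a at once, and a finite computation with integer coefficients supplies them. The hypothesis a ≥ 4
-- says that ⌊a/2⌋ ≥ 2, that is m ≥ 0, so that non-negative coefficients in m suffice. That s + s² =
-- s (1 + s) is a unit can be read off from f(0) = -1 and f(-1) = 1. The factor in a hypothetical
-- shorter period is an unknown unit, so minimality is argued with digits, which do not change under
-- scaling.

module RealArithmetic {c ℓ₁ ℓ₂ ℓ₃ : Level} (ℝ : Reals c ℓ₁ ℓ₂ ℓ₃) where
  open Reals ℝ using
    ( _≈_; _#_; _+_; _*_; -_; _-_; 0#; 1#; commutativeRing; #⇒invertible; invertible⇒#
    ; _<_; isStrictPartialOrder; #⇔<⊎>; +-monoˡ-<; *-positive; fromℤ )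
  private
    module < = IsStrictPartialOrder isStrictPartialOrder
    module ≈ = CommutativeRing commutativeRing
  open ≈ using (+-abelianGroup; ring; semiring; setoid; +-monoid)
  open MonoidMult +-monoid using (×-homo-+) renaming (_×_ to _·_)
  open SemiringMult semiring using (×1-homo-*)
  open AbelianGroupProperties +-abelianGroup using (⁻¹-∙-comm; ⁻¹-involutive; ε⁻¹≈ε)
  open RingProperties ring using (-‿distribˡ-*; -‿distribʳ-*)
  open import Relation.Binary.Reasoning.Setoid setoid

  -- Integers as real numbers.

  fromℤ-cong : ∀ {i j} → i ≡ j → fromℤ i ≈ fromℤ j
  fromℤ-cong refl = ≈.refl

  fromℤ-homo-⊖ : ∀ m n → fromℤ (m ℤ.⊖ n) ≈ m · 1# - n · 1#
  fromℤ-homo-⊖ m       zero    = ≈.sym (≈.trans (≈.+-congˡ ε⁻¹≈ε) (≈.+-identityʳ _))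
  fromℤ-homo-⊖ zero    (suc n) = ≈.sym (≈.+-identityˡ _)
  fromℤ-homo-⊖ (suc m) (suc n) = begin
    fromℤ (suc m ℤ.⊖ suc n)             ≈⟨ fromℤ-cong (ℤ.[1+m]⊖[1+n]≡m⊖n m n) ⟩
    fromℤ (m ℤ.⊖ n)                     ≈⟨ fromℤ-homo-⊖ m n ⟩
    x - y                               ≈⟨ ≈.+-congʳ (≈.+-identityʳ x) ⟨
    x + 0# - y                          ≈⟨ ≈.+-congʳ (≈.+-congˡ (≈.-‿inverseʳ 1#)) ⟨
    x + (1# - 1#) - y                   ≈⟨ ≈.+-congʳ (≈.+-assoc x 1# (- 1#)) ⟨
    x + 1# - 1# - y                     ≈⟨ ≈.+-assoc (x + 1#) (- 1#) (- y) ⟩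
    x + 1# + (- 1# - y)                 ≈⟨ ≈.+-cong (≈.+-comm x 1#) (⁻¹-∙-comm 1# y) ⟩
    1# + x - (1# + y)                   ∎
    where x = m · 1# ; y = n · 1#

  fromℤ-homo-neg : ∀ i → fromℤ (ℤ.- i) ≈ - fromℤ i
  fromℤ-homo-neg (+ zero)   = ≈.sym ε⁻¹≈ε
  fromℤ-homo-neg (+ suc n)  = ≈.refl
  fromℤ-homo-neg -[1+ n ]   = ≈.sym (⁻¹-involutive _)

  fromℤ-homo-+ : ∀ i j → fromℤ (i ℤ.+ j) ≈ fromℤ i + fromℤ j
  fromℤ-homo-+ (+ m)    (+ n)    = ×-homo-+ 1# m n
  fromℤ-homo-+ (+ m)    -[1+ n ] = fromℤ-homo-⊖ m (suc n)
  fromℤ-homo-+ -[1+ m ] (+ n)    = ≈.trans (fromℤ-homo-⊖ n (suc m)) (≈.+-comm _ _)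
  fromℤ-homo-+ -[1+ m ] -[1+ n ] = begin
    - (suc (suc (m ℕ.+ n)) · 1#)      ≡⟨ ≡.cong (λ k → - (suc k · 1#)) (ℕ.+-suc m n) ⟨
    - ((suc m ℕ.+ suc n) · 1#)        ≈⟨ ≈.-‿cong (×-homo-+ 1# (suc m) (suc n)) ⟩
    - (suc m · 1# + suc n · 1#)       ≈⟨ ⁻¹-∙-comm _ _ ⟨
    - (suc m · 1#) - suc n · 1#       ∎


  fromℤ-homo-*⁺ : ∀ m j → fromℤ (+ m ℤ.* j) ≈ fromℤ (+ m) * fromℤ j
  fromℤ-homo-*⁺ m (+ n) = begin
    fromℤ (+ m ℤ.* + n)  ≈⟨ fromℤ-cong (ℤ.pos-* m n) ⟨
    fromℤ (+ (m ℕ.* n))  ≈⟨ ×1-homo-* m n ⟩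
    fromℤ (+ m) * fromℤ (+ n) ∎
  fromℤ-homo-*⁺ m -[1+ n ] = begin
    fromℤ (+ m ℤ.* -[1+ n ])            ≈⟨ fromℤ-cong (ℤ.neg-distribʳ-* (+ m) (+ suc n)) ⟨
    fromℤ (ℤ.- (+ m ℤ.* + suc n))       ≈⟨ fromℤ-homo-neg (+ m ℤ.* + suc n) ⟩
    - fromℤ (+ m ℤ.* + suc n)           ≈⟨ ≈.-‿cong (fromℤ-homo-*⁺ m (+ suc n)) ⟩
    - (fromℤ (+ m) * fromℤ (+ suc n))   ≈⟨ -‿distribʳ-* _ _ ⟩
    fromℤ (+ m) * fromℤ -[1+ n ]        ∎

  fromℤ-homo-* : ∀ i j → fromℤ (i ℤ.* j) ≈ fromℤ i * fromℤ j
  fromℤ-homo-* (+ m)    j = fromℤ-homo-*⁺ m j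
  fromℤ-homo-* -[1+ m ] j = begin
    fromℤ (-[1+ m ] ℤ.* j)              ≈⟨ fromℤ-cong (ℤ.neg-distribˡ-* (+ suc m) j) ⟨
    fromℤ (ℤ.- (+ suc m ℤ.* j))         ≈⟨ fromℤ-homo-neg (+ suc m ℤ.* j) ⟩
    - fromℤ (+ suc m ℤ.* j)             ≈⟨ ≈.-‿cong (fromℤ-homo-*⁺ (suc m) j) ⟩
    - (fromℤ (+ suc m) * fromℤ j)       ≈⟨ -‿distribˡ-* _ _ ⟩
    fromℤ -[1+ m ] * fromℤ j            ∎

  fromℤ-1 : fromℤ (+ 1) ≈ 1#
  fromℤ-1 = ≈.+-identityʳ 1#

  private
    fromℤ-morphism : ℤ.+-*-rawRing -Raw-AlmostCommutative⟶ fromCommutativeRing commutativeRing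
    fromℤ-morphism = record
      { ⟦_⟧    = fromℤ
      ; +-homo = fromℤ-homo-+
      ; *-homo = fromℤ-homo-*
      ; -‿homo = fromℤ-homo-neg
      ; 0-homo = ≈.refl
      ; 1-homo = fromℤ-1
      }

    fromℤ-≟ : ∀ i j → Maybe (fromℤ i ≈ fromℤ j)
    fromℤ-≟ i j = Maybe.map fromℤ-cong (dec⇒maybe (i ℤ.≟ j))

  -- With ℤ as coefficient ring, `con i` denotes `fromℤ i`. In particular `con (+ 1)` denotes
  -- `1# + 0#`, which is why many equations below contain `fromℤ (+ 1)` instead of `1#`.
  open RingSolver ℤ.+-*-rawRing (fromCommutativeRing commutativeRing) fromℤ-morphism fromℤ-≟ public
    using (solve; _:=_; con; _:+_; _:-_; _:*_; :-_)

  -- Order without decidable trichotomy, and floors.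

  <-respʳ : ∀ {x y z} → y ≈ z → x < y → x < z
  <-respʳ = <.<-respʳ-≈

  <-respˡ : ∀ {x y z} → y ≈ z → y < x → z < x
  <-respˡ = <.<-respˡ-≈

  <-resp₂ : ∀ {x y z w} → x ≈ y → z ≈ w → x < z → y < w
  <-resp₂ p q r = <-respʳ q (<-respˡ p r)

  <⇒0<- : ∀ {x y} → x < y → 0# < y - x
  <⇒0<- {x} x<y = <-respˡ (≈.-‿inverseʳ x) (+-monoˡ-< (- x) x<y)

  0<-⇒< : ∀ {x y} → 0# < y - x → x < y
  0<-⇒< {x} {y} 0<y-x = <-resp₂ (≈.+-identityˡ x)
    (solve 2 (λ x y → (y :- x) :+ x := y) (λ {_} {_} → ≈.refl) x y) (+-monoˡ-< x 0<y-x)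

  <-connected : ∀ {x y} → x # y → x < y ⊎ y < x
  <-connected {x} {y} = Equivalence.to (#⇔<⊎> x y)

  0<⇒#0 : ∀ {x} → 0# < x → x # 0#
  0<⇒#0 {x} 0<x = Equivalence.from (#⇔<⊎> x 0#) (inj₂ 0<x)

  unit⇒#0 : ∀ {x y} → x * y ≈ 1# → x # 0#
  unit⇒#0 {x} {y} xy≈1 = invertible⇒# (y , ≈.trans (≈.*-comm y _) xy≈1′ , xy≈1′)
    where
    xy≈1′ : (x - 0#) * y ≈ 1#
    xy≈1′ = ≈.trans (solve 2 (λ x y → (x :- con (+ 0)) :* y := x :* y) (λ {_} {_} → ≈.refl) x y) xy≈1

  inverseʳ : ∀ {x} (x#0 : x # 0#) → x * JacobiPerron.inv ℝ x x#0 ≈ 1#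
  inverseʳ {x} x#0 = ≈.trans
    (solve 2 (λ x y → x :* y := (x :- con (+ 0)) :* y) (λ {_} {_} → ≈.refl) x _) (proj₂ (proj₂ (#⇒invertible x#0)))

  neg-positive : ∀ {x} → x < 0# → 0# < - x
  neg-positive {x} x<0 = <-respʳ (≈.+-identityˡ (- x)) (<⇒0<- x<0)

  0<1 : 0# < 1#
  0<1 = [ (λ 1<0 → ⊥-elim (<.asym 1<0 (<-respʳ
              (≈.trans (solve 1 (λ x → :- x :* :- x := x :* x) (λ {_} → ≈.refl) 1#) (≈.*-identityˡ 1#))
              (*-positive (neg-positive 1<0) (neg-positive 1<0)))))
        , (λ 0<1 → 0<1) ]′ (<-connected (unit⇒#0 (≈.*-identityˡ 1#)))

  <-asym : ∀ {x y} → x < y → ¬ (y < x)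
  <-asym = <.asym

  +-positive : ∀ {x y} → 0# < x → 0# < y → 0# < x + y
  +-positive {x} {y} 0<x 0<y = <.trans 0<y (<-respˡ (≈.+-identityˡ y) (+-monoˡ-< y 0<x))

  -- The sign of `y` cannot be found by comparison with zero. But `x * y` is invertible, hence so is
  -- `y`, and an invertible element is apart from zero; the negative case contradicts the sign of
  -- the product.
  *-cancel-positive : ∀ {x y} → 0# < x → 0# < x * y → 0# < y
  *-cancel-positive {x} {y} 0<x 0<xy = [ impossible , (λ 0<y → 0<y) ]′ (<-connected (unit⇒#0 y-unit))
    where
    z = JacobiPerron.inv ℝ (x * y) (0<⇒#0 0<xy)
    y-unit : y * (x * z) ≈ 1#
    y-unit = ≈.trans (solve 3 (λ x y z → y :* (x :* z) := x :* y :* z) (λ {_} {_} {_} → ≈.refl) x y z) (inverseʳ (0<⇒#0 0<xy))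
    impossible : y < 0# → 0# < y
    impossible y<0 = ⊥-elim (<.asym 0<xy (0<-⇒< (<-respʳ
      (solve 2 (λ x y → x :* :- y := con (+ 0) :- x :* y) (λ {_} {_} → ≈.refl) x y) (*-positive 0<x (neg-positive y<0)))))

  fromℤ-positive : ∀ n → 0# < fromℤ (+ suc n)
  fromℤ-positive zero    = <-respʳ (≈.sym (≈.+-identityʳ 1#)) 0<1
  fromℤ-positive (suc n) = +-positive 0<1 (fromℤ-positive n)

  fromℤ-≤-<-trans : ∀ {x i j} → x < fromℤ i → i ℤ.≤ j → x < fromℤ j
  fromℤ-≤-<-trans {x} {i} {j} x<i i≤j with j ℤ.- i in eq | ℤ.i≤j⇒0≤j-i i≤j
  ... | + zero  | _ = <-respʳ (fromℤ-cong (≡.sym (ℤ.i-j≡0⇒i≡j j i eq))) x<i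
  ... | + suc k | _ = <.trans x<i (0<-⇒< (<-respʳ (begin
    fromℤ (+ suc k)       ≈⟨ fromℤ-cong eq ⟨
    fromℤ (j ℤ.- i)       ≈⟨ fromℤ-homo-+ j (ℤ.- i) ⟩
    fromℤ j + fromℤ (ℤ.- i)  ≈⟨ ≈.+-congˡ (fromℤ-homo-neg i) ⟩
    fromℤ j - fromℤ i     ∎) (fromℤ-positive k)))

  -- As `_≤_` is only the negation of `_<_`, non-negativity is kept on the integer side, where zero
  -- and positive can be told apart.
  +-nonNegative-* : ∀ {i x y} → ℤ.0ℤ ℤ.≤ i → 0# < x → 0# < y → 0# < y + fromℤ i * x
  +-nonNegative-* {+ zero}  {x} {y} _ _ 0<y =
    <-respʳ (solve 2 (λ x y → y := y :+ con (+ 0) :* x) (λ {_} {_} → ≈.refl) x y) 0<y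
  +-nonNegative-* {+ suc n} _ 0<x 0<y = +-positive 0<y (*-positive (fromℤ-positive n) 0<x)

  open JacobiPerron ℝ

  IsFloor-resp : ∀ {x y} n → x ≈ y → IsFloor x n → IsFloor y n
  IsFloor-resp n x≈y (n≤x , x<n+1) = (λ y<n → n≤x (<-respˡ (≈.sym x≈y) y<n)) , <-respˡ x≈y x<n+1

  private
    IsFloor-≮ : ∀ {x} m n → IsFloor x m → IsFloor x n → ¬ (m ℤ.< n)
    IsFloor-≮ m n (_ , x<m+1) (n≤x , _) m<n = n≤x (fromℤ-≤-<-trans (<-respʳ m+1≈1+m x<m+1) (ℤ.i<j⇒suc[i]≤j m<n))
      where
      m+1≈1+m : fromℤ m + 1# ≈ fromℤ (+ 1 ℤ.+ m)
      m+1≈1+m = begin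
        fromℤ m + 1#           ≈⟨ ≈.+-comm _ _ ⟩
        1# + fromℤ m           ≈⟨ ≈.+-congʳ fromℤ-1 ⟨
        fromℤ (+ 1) + fromℤ m  ≈⟨ fromℤ-homo-+ (+ 1) m ⟨
        fromℤ (+ 1 ℤ.+ m)      ∎

  IsFloor-unique : ∀ {x} m n → IsFloor x m → IsFloor x n → m ≡ n
  IsFloor-unique m n fm fn with ℤ.<-cmp m n
  ... | tri< m<n _ _ = ⊥-elim (IsFloor-≮ m n fm fn m<n)
  ... | tri≈ _ m≡n _ = m≡n
  ... | tri> _ _ n<m = ⊥-elim (IsFloor-≮ n m fn fm n<m)

T-∧⁻ : ∀ x {y} → T (x ∧ y) → T x × T y
T-∧⁻ true h = tt , h

-- Integer polynomials with sign tests on their coefficients.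

module IntegerPolynomials where
  open import Data.Integer.Base using (_+_; _*_; _-_; _≤_; _≤ᵇ_; 0ℤ; 1ℤ; -1ℤ)

  infixl 6 _+ₚ_ _-ₚ_
  infixl 7 _*ₚ_

  -- Coefficients from the constant term upwards.
  Poly : Set
  Poly = List ℤ

  eval : Poly → ℤ → ℤ
  eval []       x = 0ℤ
  eval (c ∷ cs) x = c + x * eval cs x

  _+ₚ_ : Poly → Poly → Poly
  []       +ₚ q        = q
  (c ∷ cs) +ₚ []       = c ∷ cs
  (c ∷ cs) +ₚ (d ∷ ds) = c + d ∷ cs +ₚ ds

  scale : ℤ → Poly → Poly
  scale c = List.map (c *_)

  _-ₚ_ : Poly → Poly → Poly
  p -ₚ q = p +ₚ scale -1ℤ q

  _*ₚ_ : Poly → Poly → Poly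
  []       *ₚ q = []
  (c ∷ cs) *ₚ q = scale c q +ₚ (0ℤ ∷ cs *ₚ q)

  eval-+ : ∀ p q x → eval (p +ₚ q) x ≡ eval p x + eval q x
  eval-+ []       q        x = ≡.sym (ℤ.+-identityˡ _)
  eval-+ (c ∷ cs) []       x = ≡.sym (ℤ.+-identityʳ _)
  eval-+ (c ∷ cs) (d ∷ ds) x =
    ≡.trans (≡.cong (λ z → c + d + x * z) (eval-+ cs ds x)) (rearrange c d x (eval cs x) (eval ds x))
    where
    rearrange : ∀ c d x y z → c + d + x * (y + z) ≡ (c + x * y) + (d + x * z)
    rearrange = solve-∀

  eval-scale : ∀ c p x → eval (scale c p) x ≡ c * eval p x
  eval-scale c []       x = ≡.sym (ℤ.*-zeroʳ c)
  eval-scale c (d ∷ ds) x =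
    ≡.trans (≡.cong (λ z → c * d + x * z) (eval-scale c ds x)) (rearrange c d x (eval ds x))
    where
    rearrange : ∀ c d x y → c * d + x * (c * y) ≡ c * (d + x * y)
    rearrange = solve-∀

  eval-- : ∀ p q x → eval (p -ₚ q) x ≡ eval p x - eval q x
  eval-- p q x = ≡.trans (eval-+ p (scale -1ℤ q) x)
    (≡.cong (λ z → eval p x + z) (≡.trans (eval-scale -1ℤ q x) (ℤ.-1*i≡-i (eval q x))))

  eval-* : ∀ p q x → eval (p *ₚ q) x ≡ eval p x * eval q x
  eval-* []       q x = refl
  eval-* (c ∷ cs) q x = ≡.trans (eval-+ (scale c q) (0ℤ ∷ cs *ₚ q) x)
    (≡.trans (≡.cong₂ (λ y z → y + (0ℤ + x * z)) (eval-scale c q x) (eval-* cs q x))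
      (rearrange c x (eval cs x) (eval q x)))
    where
    rearrange : ∀ c x y z → c * z + (0ℤ + x * (y * z)) ≡ (c + x * y) * z
    rearrange = solve-∀

  -- Sufficient tests for all natural arguments at once. Lists may carry trailing zeros, so equality
  -- is tested by `zero?` of a difference.
  nonNegative positive zero? : Poly → Bool
  nonNegative []       = true
  nonNegative (c ∷ cs) = (0ℤ ≤ᵇ c) ∧ nonNegative cs
  positive p = nonNegative (p -ₚ (1ℤ ∷ []))
  zero? []       = true
  zero? (c ∷ cs) = ⌊ c ℤ.≟ 0ℤ ⌋ ∧ zero? cs

  eval-nonNegative : ∀ p → T (nonNegative p) → ∀ m → 0ℤ ≤ eval p (+ m)
  eval-nonNegative []       _ m = ℤ.≤-refl
  eval-nonNegative (c ∷ cs) h m = let (0≤c , 0≤cs) = T-∧⁻ (0ℤ ≤ᵇ c) h in ℤ.+-mono-≤ (ℤ.≤ᵇ⇒≤ {0ℤ} {c} 0≤c)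
    (≡.subst (_≤ + m * eval cs (+ m)) (ℤ.*-zeroʳ (+ m)) (ℤ.*-monoˡ-≤-nonNeg (+ m) (eval-nonNegative cs 0≤cs m)))

  eval-positive : ∀ p → T (positive p) → ∀ m → 1ℤ ≤ eval p (+ m)
  eval-positive p h m = ℤ.0≤i-j⇒j≤i (≡.subst (0ℤ ≤_)
    (≡.trans (eval-- p (1ℤ ∷ []) (+ m))
      (≡.cong (λ z → eval p (+ m) - (1ℤ + z)) (ℤ.*-zeroʳ (+ m))))
    (eval-nonNegative (p -ₚ (1ℤ ∷ [])) h m))

  eval-zero : ∀ p → T (zero? p) → ∀ x → eval p x ≡ 0ℤ
  eval-zero []       _ x = refl
  eval-zero (c ∷ cs) h x = let (c≡0 , cs≡0) = T-∧⁻ ⌊ c ℤ.≟ 0ℤ ⌋ h in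
    ≡.trans (≡.cong₂ (λ y z → y + x * z) (toWitness {a? = c ℤ.≟ 0ℤ} c≡0) (eval-zero cs cs≡0 x)) (≡.trans (ℤ.+-identityˡ _) (ℤ.*-zeroʳ x))

  eval-≡ : ∀ p q → T (zero? (p -ₚ q)) → ∀ x → eval p x ≡ eval q x
  eval-≡ p q h x = ℤ.i-j≡0⇒i≡j _ _ (≡.trans (≡.sym (eval-- p q x)) (eval-zero (p -ₚ q) h x))

open IntegerPolynomials

-- Symbolic arithmetic in the cubic order, with the digits and the checks.

-- For the parity δ put a = 2 (m + 2) + δ.  An element ⟨ p , q , r ⟩ stands for p + q s + r s² with
-- s³ = 1 + (a + 3) s + a s², where p, q and r are polynomials in m.
module CubicOrder (δ : Fin 2) where
  data Elem : Set where
    ⟨_,_,_⟩ : (p q r : Poly) → Elem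

  data Vector : Set where
    ⟪_,_,_⟫ : (x y z : Elem) → Vector

  aₚ Aₚ : Poly
  aₚ = + (4 ℕ.+ toℕ δ) ∷ + 2 ∷ []
  Aₚ = + 2 ∷ + 1 ∷ []

  infixl 6 _⊕_ _⊖[_]_

  _⊕_ : Elem → Elem → Elem
  ⟨ p , q , r ⟩ ⊕ ⟨ p′ , q′ , r′ ⟩ = ⟨ p +ₚ p′ , q +ₚ q′ , r +ₚ r′ ⟩

  _⊖[_]_ : Elem → Poly → Elem → Elem
  ⟨ p , q , r ⟩ ⊖[ b ] ⟨ p′ , q′ , r′ ⟩ = ⟨ p -ₚ b *ₚ p′ , q -ₚ b *ₚ q′ , r -ₚ b *ₚ r′ ⟩

  -- The second rests on 1/s = s² - a s - (a + 3), so division by s is multiplication by t.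
  multiply-s divide-s : Elem → Elem
  multiply-s ⟨ p , q , r ⟩ = ⟨ r , p +ₚ (aₚ +ₚ (+ 3 ∷ [])) *ₚ r , q +ₚ aₚ *ₚ r ⟩
  divide-s   ⟨ p , q , r ⟩ = ⟨ q -ₚ (aₚ +ₚ (+ 3 ∷ [])) *ₚ p , r -ₚ aₚ *ₚ p , p ⟩

  unity -ρ ρ² : Elem
  unity = ⟨ + 1 ∷ [] , [] , [] ⟩
  -- From t = -1 - ρ follow -ρ = 1 + t and ρ² = -ρ (1 + t).
  -ρ    = unity ⊕ divide-s unity
  ρ²    = -ρ ⊕ divide-s -ρ

  -- The pairs (b₂, b₃). The parity of a first matters at position 4, where b₃ = ⌊a/2⌋; the
  -- remainder δ then enters at positions 5 and 7.
  digits : ℕ → Poly × Poly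
  digits 0 = + 1 ∷ [] , + 1 ∷ []
  digits 1 = + 2 ∷ [] , aₚ +ₚ (+ 1 ∷ [])
  digits 2 = + 1 ∷ [] , aₚ +ₚ (+ 1 ∷ [])
  digits 3 = [] , + 1 ∷ []
  digits 4 = [] , Aₚ
  digits 5 = + toℕ δ ∷ [] , + 2 ∷ []
  digits 6 = [] , + 1 ∷ []
  digits 7 = Aₚ -ₚ (+ 2 ∷ []) , Aₚ +ₚ (+ (3 ℕ.+ toℕ δ) ∷ [])
  digits 8 = + 1 ∷ [] , aₚ +ₚ (+ 2 ∷ [])
  digits (suc (suc (suc (suc (suc (suc (suc (suc (suc n))))))))) = digits (suc (suc n))

  next : Poly × Poly → Vector → Vector
  next (b , c) ⟪ x , y , z ⟫ = ⟪ y ⊖[ b ] x , z ⊖[ c ] x , x ⟫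

  vector : ℕ → Vector
  vector zero    = ⟪ unity , -ρ , ρ² ⟫
  vector (suc k) = next (digits k) (vector k)

  multiply-s+s² : Elem → Elem
  multiply-s+s² x = multiply-s (x ⊕ multiply-s x)

  -- The companion matrix of s is non-negative, hence by Perron–Frobenius the coefficients of sᵏ x are eventually
  -- positive if x is; the exponent 12 suffices for all elements below.
  positiveAfter : ℕ → Elem → Bool
  positiveAfter zero    ⟨ p , q , r ⟩ = positive p ∧ nonNegative q ∧ nonNegative r
  positiveAfter (suc k) x             = positiveAfter k (multiply-s x)

  positiveElem : Elem → Bool
  positiveElem = positiveAfter 12

  -- Both quotients have fractional parts strictly between 0 and 1, so a floor is certified by
  -- strict positivity of the remainder and of `x` minus the remainder.
  validStep : Poly × Poly → Vector → Bool
  validStep (b , c) ⟪ x , y , z ⟫ = positiveElem x ∧ residue (y ⊖[ b ] x) ∧ residue (z ⊖[ c ] x)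
    where
    residue : Elem → Bool
    residue y = positiveElem y ∧ positiveElem (x ⊖[ + 1 ∷ [] ] y)

  equalElem : Elem → Elem → Bool
  equalElem ⟨ p , q , r ⟩ ⟨ p′ , q′ , r′ ⟩ = zero? (p -ₚ p′) ∧ zero? (q -ₚ q′) ∧ zero? (r -ₚ r′)

  multiple : Vector → Vector → Bool
  multiple ⟪ x , y , z ⟫ ⟪ x′ , y′ , z′ ⟫ = equal x x′ ∧ equal y y′ ∧ equal z z′
    where
    equal : Elem → Elem → Bool
    equal x x′ = equalElem (multiply-s+s² (multiply-s+s² x)) x′

-- With δ a constructor the checks are closed computations in which m stays formal.
validStep-holds : ∀ δ (k : Fin 9) → T (CubicOrder.validStep δ (CubicOrder.digits δ (toℕ k)) (CubicOrder.vector δ (toℕ k)))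
validStep-holds 0F = toWitness
  {a? = all? (λ k → T? (CubicOrder.validStep 0F (CubicOrder.digits 0F (toℕ k)) (CubicOrder.vector 0F (toℕ k))))} tt
validStep-holds 1F = toWitness
  {a? = all? (λ k → T? (CubicOrder.validStep 1F (CubicOrder.digits 1F (toℕ k)) (CubicOrder.vector 1F (toℕ k))))} tt

-- A record and not a synonym, so that unification compares the indices instead of unfolding the vectors.
record Closes (δ : Fin 2) (j k : ℕ) : Set where
  constructor closed
  field
    isMultiple : T (CubicOrder.multiple δ (CubicOrder.vector δ j) (CubicOrder.vector δ k))

closes : ∀ δ → Closes δ 9 2
closes 0F = closed tt
closes 1F = closed tt

-- Positions 1 and 2 miss the maximum a + 2 by 1. At position 7 the gap is ⌊a/2⌋ - 1 = m + 1.
thirdDigit-maximal : ∀ δ (k : Fin 8) → T (positive (CubicOrder.digits δ 8 .proj₂ -ₚ CubicOrder.digits δ (toℕ k) .proj₂))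
thirdDigit-maximal 0F = toWitness
  {a? = all? (λ k → T? (positive (CubicOrder.digits 0F 8 .proj₂ -ₚ CubicOrder.digits 0F (toℕ k) .proj₂)))} tt
thirdDigit-maximal 1F = toWitness
  {a? = all? (λ k → T? (positive (CubicOrder.digits 1F 8 .proj₂ -ₚ CubicOrder.digits 1F (toℕ k) .proj₂)))} tt

-- Scaling and uniqueness of digits and expansions.

module Expansions {c ℓ₁ ℓ₂ ℓ₃ : Level} (ℝ : Reals c ℓ₁ ℓ₂ ℓ₃) where
  open Reals ℝ using
    (_≈_; _#_; _+_; _*_; _-_; 0#; 1#; commutativeRing; _<_; *-positive; fromℤ)
  open JacobiPerron ℝ
  open RealArithmetic ℝ
  private module ≈ = CommutativeRing commutativeRing
  open import Relation.Binary.Reasoning.Setoid ≈.setoid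

  ≋-refl : ∀ {x} → x ≋ x
  ≋-refl = ≈.refl , ≈.refl , ≈.refl

  ≋-reflexive : ∀ {x y} → x ≡ y → x ≋ y
  ≋-reflexive refl = ≋-refl

  ≋-sym : ∀ {x y} → x ≋ y → y ≋ x
  ≋-sym (p , q , r) = ≈.sym p , ≈.sym q , ≈.sym r

  ≋-trans : ∀ {x y z} → x ≋ y → y ≋ z → x ≋ z
  ≋-trans (p , q , r) (p′ , q′ , r′) = ≈.trans p p′ , ≈.trans q q′ , ≈.trans r r′

  ⊙-cong : ∀ {x y} ε → x ≋ y → ε ⊙ x ≋ ε ⊙ y
  ⊙-cong ε (p , q , r) = ≈.*-congˡ p , ≈.*-congˡ q , ≈.*-congˡ r

  1⊙ : ∀ x → 1# ⊙ x ≋ x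
  1⊙ x = ≈.*-identityˡ _ , ≈.*-identityˡ _ , ≈.*-identityˡ _

  -- The part of `Step` that concerns `x` alone. The digits are an index instead of existential
  -- witnesses, so that those of different vectors can be compared.
  record Digits (x : ℝ³) (bd : ℤ × ℤ) : Set (ℓ₂ ⊔ ℓ₃) where
    constructor mkDigits
    field
      nonzero : proj₁ x # 0#
      floor₂  : IsFloor (proj₁ (proj₂ x) * inv (proj₁ x) nonzero) (proj₁ bd)
      floor₃  : IsFloor (proj₂ (proj₂ x) * inv (proj₁ x) nonzero) (proj₂ bd)

  residue : ℤ × ℤ → ℝ³ → ℝ³
  residue (b , d) (x₁ , x₂ , x₃) = x₂ - fromℤ b * x₁ , x₃ - fromℤ d * x₁ , x₁

  step : ∀ {x x′} bd → Digits x bd → x′ ≋ residue bd x → Step x x′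
  step (b , d) (mkDigits x₁#0 fb fd) eq = x₁#0 , b , d , fb , fd , eq

  step⁻¹ : ∀ x x′ → Step x x′ → ∃[ bd ] (Digits x bd × x′ ≋ residue bd x)
  step⁻¹ x x′ (x₁#0 , b , d , fb , fd , eq) = (b , d) , mkDigits x₁#0 fb fd , eq

  private
    -- Insert `x′ * j ≈ 1#`, regroup, and use `ε * x′ * i ≈ x * i ≈ 1#`. The common factor may have
    -- either sign.
    quotient-scale : ∀ {ε x y x′ y′} (x#0 : x # 0#) (x′#0 : x′ # 0#) → x ≈ ε * x′ → y ≈ ε * y′ →
                     y * inv x x#0 ≈ y′ * inv x′ x′#0
    quotient-scale {ε} {x} {y} {x′} {y′} x#0 x′#0 x≈εx′ y≈εy′ = begin
      y * i               ≈⟨ ≈.*-identityʳ _ ⟨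
      y * i * 1#          ≈⟨ ≈.*-cong (≈.*-congʳ y≈εy′) (≈.sym (inverseʳ x′#0)) ⟩
      ε * y′ * i * (x′ * j)  ≈⟨ solve 5 (λ ε y′ i x′ j → ε :* y′ :* i :* (x′ :* j) := y′ :* j :* (ε :* x′ :* i))
                                  (λ {_} {_} {_} {_} {_} → ≈.refl) ε y′ i x′ j ⟩
      y′ * j * (ε * x′ * i)  ≈⟨ ≈.*-congˡ (≈.trans (≈.*-congʳ (≈.sym x≈εx′)) (inverseʳ x#0)) ⟩
      y′ * j * 1#         ≈⟨ ≈.*-identityʳ _ ⟩
      y′ * j              ∎
      where i = inv x x#0 ; j = inv x′ x′#0

  Digits-unique : ∀ {ε x y} {bd bd′ : ℤ × ℤ} → x ≋ ε ⊙ y → Digits x bd → Digits y bd′ → bd ≡ bd′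
  Digits-unique {bd = b , d} {b′ , d′} (p , q , r) (mkDigits x₁#0 fb fd) (mkDigits y₁#0 fb′ fd′) = ≡.cong₂ _,_
    (IsFloor-unique b b′ (IsFloor-resp b (quotient-scale x₁#0 y₁#0 p q) fb) fb′)
    (IsFloor-unique d d′ (IsFloor-resp d (quotient-scale x₁#0 y₁#0 p r) fd) fd′)

  Digits-scale : ∀ {ε x y bd} → proj₁ x # 0# → x ≋ ε ⊙ y → Digits y bd → Digits x bd
  Digits-scale {bd = b , d} x₁#0 (p , q , r) (mkDigits y₁#0 fb fd) = mkDigits x₁#0
    (IsFloor-resp b (≈.sym (quotient-scale x₁#0 y₁#0 p q)) fb)
    (IsFloor-resp d (≈.sym (quotient-scale x₁#0 y₁#0 p r)) fd)

  residue-scale : ∀ {ε x y} bd → x ≋ ε ⊙ y → residue bd x ≋ ε ⊙ residue bd y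
  residue-scale {ε} {x} {y} (b , d) (p , q , r) = coordinate b q , coordinate d r , p
    where
    coordinate : ∀ {u v} n → u ≈ ε * v → u - fromℤ n * proj₁ x ≈ ε * (v - fromℤ n * proj₁ y)
    coordinate {u} {v} n u≈εv = ≈.trans (≈.+-cong u≈εv (≈.-‿cong (≈.*-congˡ p)))
      (solve 4 (λ ε v n w → ε :* v :- n :* (ε :* w) := ε :* (v :- n :* w))
        (λ {_} {_} {_} {_} → ≈.refl) ε v (fromℤ n) (proj₁ y))

  residue-cong : ∀ {x y} bd → x ≋ y → residue bd x ≋ residue bd y
  residue-cong (b , d) (p , q , r) =
    ≈.+-cong q (≈.-‿cong (≈.*-congˡ p)) , ≈.+-cong r (≈.-‿cong (≈.*-congˡ p)) , p

  -- The inverse of `x₁` is positive, so multiplying by it turns n x₁ < x < (n + 1) x₁ into bounds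
  -- on the quotient.
  Digits-positive : ∀ {x₁ x₂ x₃} b d → let (y₁ , y₂ , _) = residue (b , d) (x₁ , x₂ , x₃) in
    0# < x₁ → 0# < y₁ → 0# < x₁ - y₁ → 0# < y₂ → 0# < x₁ - y₂ → Digits (x₁ , x₂ , x₃) (b , d)
  Digits-positive {x₁} b d 0<x₁ 0<y₁ y₁<x₁ 0<y₂ y₂<x₁ = mkDigits x₁#0 (floor b 0<y₁ y₁<x₁) (floor d 0<y₂ y₂<x₁)
    where
    x₁#0 = 0<⇒#0 0<x₁
    i = inv x₁ x₁#0

    0<i : 0# < i
    0<i = *-cancel-positive 0<x₁ (<-respʳ (≈.sym (inverseʳ x₁#0)) 0<1)

    floor : ∀ {x} n → 0# < x - fromℤ n * x₁ → 0# < x₁ - (x - fromℤ n * x₁) → IsFloor (x * i) n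
    floor {x} n 0<y y<x₁ = (λ xi<n → <-asym xi<n n<xi) , xi<n+1
      where
      n<xi : fromℤ n < x * i
      n<xi = 0<-⇒< (<-respʳ (begin
        (x - fromℤ n * x₁) * i        ≈⟨ solve 4 (λ x n x₁ i → (x :- n :* x₁) :* i := x :* i :- n :* (x₁ :* i))
                                          (λ {_} {_} {_} {_} → ≈.refl) x (fromℤ n) x₁ i ⟩
        x * i - fromℤ n * (x₁ * i)    ≈⟨ ≈.+-congˡ (≈.-‿cong (≈.trans (≈.*-congˡ (inverseʳ x₁#0)) (≈.*-identityʳ _))) ⟩
        x * i - fromℤ n               ∎) (*-positive 0<y 0<i))

      xi<n+1 : x * i < fromℤ n + 1#
      xi<n+1 = 0<-⇒< (<-respʳ (begin
        (x₁ - (x - fromℤ n * x₁)) * i ≈⟨ solve 4 (λ x n x₁ i →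
                                          (x₁ :- (x :- n :* x₁)) :* i := n :* (x₁ :* i) :+ x₁ :* i :- x :* i)
                                          (λ {_} {_} {_} {_} → ≈.refl) x (fromℤ n) x₁ i ⟩
        fromℤ n * (x₁ * i) + x₁ * i - x * i
          ≈⟨ ≈.+-congʳ (≈.+-cong (≈.trans (≈.*-congˡ (inverseʳ x₁#0)) (≈.*-identityʳ _)) (inverseʳ x₁#0)) ⟩
        fromℤ n + 1# - x * i          ∎) (*-positive y<x₁ 0<i))

  residue-deterministic : ∀ {x y x′ y′ bd bd′} → x ≋ y → Digits x bd → Digits y bd′ →
    x′ ≋ residue bd x → y′ ≋ residue bd′ y → x′ ≋ y′
  residue-deterministic {x} {y} {bd = bd} {bd′} x≋y ds ds′ x′≋ y′≋ =
    ≋-trans x′≋ (≋-trans (residue-cong bd x≋y) (≋-sym (≋-trans y′≋ (residue-≡ (≡.sym bd≡bd′)))))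
    where
    bd≡bd′ : bd ≡ bd′
    -- Equal vectors are proportional ones with factor 1.
    bd≡bd′ = Digits-unique (≋-trans x≋y (≋-sym (1⊙ y))) ds ds′
    residue-≡ : ∀ {bd bd′} → bd ≡ bd′ → residue bd y ≋ residue bd′ y
    residue-≡ refl = ≋-refl

  Step-deterministic : ∀ x y x′ y′ → x ≋ y → Step x x′ → Step y y′ → x′ ≋ y′
  Step-deterministic x y x′ y′ x≋y st st′ =
    let (_ , ds , x′≋) = step⁻¹ x x′ st ; (_ , ds′ , y′≋) = step⁻¹ y y′ st′ in
    residue-deterministic x≋y ds ds′ x′≋ y′≋

  -- Since `Step` is a relation, an expansion is not given by recursion. This lemma transfers what
  -- is known of one explicit expansion to all of them.
  expansion-unique : ∀ {v β γ} → IsExpansion v β → IsExpansion v γ → ∀ k → β k ≋ γ k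
  expansion-unique (β₀ , _) (γ₀ , _) zero = ≋-trans β₀ (≋-sym γ₀)
  expansion-unique eβ@(_ , stepβ) eγ@(_ , stepγ) (suc k) =
    Step-deterministic _ _ _ _ (expansion-unique eβ eγ k) (stepβ k) (stepγ k)

-- The real values of the symbolic elements, and the unit.

module SimplestCubic
  {c ℓ₁ ℓ₂ ℓ₃ : Level} (ℝ : Reals c ℓ₁ ℓ₂ ℓ₃) (δ : Fin 2) (m : ℕ) (ρ : Reals.Carrier ℝ)
  where
  open CubicOrder δ renaming (-ρ to -ρᴱ; ρ² to ρ²ᴱ; digits to digitsₚ)
  open Reals ℝ using
    (Carrier; _≈_; _#_; _+_; _*_; _-_; -_; 0#; 1#; commutativeRing; _<_; *-positive; fromℤ)
  open JacobiPerron ℝ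
  open RealArithmetic ℝ
  open Expansions ℝ
  private module ≈ = CommutativeRing commutativeRing
  open import Relation.Binary.Reasoning.Setoid ≈.setoid

  -- Remainder plus quotient times 2, the shape that division with remainder delivers, so that
  -- `halve` can be matched by `refl`.
  A a : ℤ
  A = + (2 ℕ.+ m)
  a = + toℕ δ ℤ.+ A ℤ.* + 2

  private
    α = fromℤ a

    fromℤ-homo-- : ∀ i j → fromℤ (i ℤ.- j) ≈ fromℤ i - fromℤ j
    fromℤ-homo-- i j = ≈.trans (fromℤ-homo-+ i (ℤ.- j)) (≈.+-congˡ (fromℤ-homo-neg j))

  evalᴿ : Poly → Carrier
  evalᴿ p = fromℤ (eval p (+ m))

  eval-aₚ : eval aₚ (+ m) ≡ a
  eval-aₚ = rearrange (+ toℕ δ) (+ m)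
    where
    rearrange : ∀ d m → (+ 4 ℤ.+ d) ℤ.+ m ℤ.* (+ 2 ℤ.+ m ℤ.* + 0) ≡ d ℤ.+ (+ 2 ℤ.+ m) ℤ.* + 2
    rearrange = solve-∀

  evalᴿ-aₚ : evalᴿ aₚ ≈ α
  evalᴿ-aₚ = fromℤ-cong eval-aₚ

  evalᴿ-con : ∀ i → evalᴿ (i ∷ []) ≈ fromℤ i
  evalᴿ-con i = fromℤ-cong (≡.trans (≡.cong (λ z → i ℤ.+ z) (ℤ.*-zeroʳ (+ m))) (ℤ.+-identityʳ i))

  evalᴿ-+ : ∀ p q → evalᴿ (p +ₚ q) ≈ evalᴿ p + evalᴿ q
  evalᴿ-+ p q = ≈.trans (fromℤ-cong (eval-+ p q (+ m))) (fromℤ-homo-+ (eval p (+ m)) (eval q (+ m)))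

  evalᴿ-* : ∀ p q → evalᴿ (p *ₚ q) ≈ evalᴿ p * evalᴿ q
  evalᴿ-* p q = ≈.trans (fromℤ-cong (eval-* p q (+ m))) (fromℤ-homo-* (eval p (+ m)) (eval q (+ m)))

  evalᴿ-- : ∀ p q → evalᴿ (p -ₚ q) ≈ evalᴿ p - evalᴿ q
  evalᴿ-- p q = ≈.trans (fromℤ-cong (eval-- p q (+ m))) (fromℤ-homo-- (eval p (+ m)) (eval q (+ m)))

  evalᴿ-a+3 : ∀ p → evalᴿ ((aₚ +ₚ (+ 3 ∷ [])) *ₚ p) ≈ (α + fromℤ (+ 3)) * evalᴿ p
  evalᴿ-a+3 p = ≈.trans (evalᴿ-* (aₚ +ₚ (+ 3 ∷ [])) p)
    (≈.*-congʳ (≈.trans (evalᴿ-+ aₚ (+ 3 ∷ [])) (≈.+-cong evalᴿ-aₚ (evalᴿ-con (+ 3)))))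

  evalᴿ-a* : ∀ p → evalᴿ (aₚ *ₚ p) ≈ α * evalᴿ p
  evalᴿ-a* p = ≈.trans (evalᴿ-* aₚ p) (≈.*-congʳ evalᴿ-aₚ)

  -- The constant term 1 makes this class closed under inversion; t, s, η and ε all belong to it.
  Root : (c₁ c₂ x : Carrier) → Set ℓ₁
  Root c₁ c₂ x = x * x * x ≈ c₂ * (x * x) + c₁ * x + fromℤ (+ 1)

  Root-integral : ∀ {x} c₁ c₂ → Root (fromℤ c₁) (fromℤ c₂) x → AlgebraicInteger x
  Root-integral {x} c₁ c₂ root = (-[1+ 0 ] ∷ ℤ.- c₁ ∷ ℤ.- c₂ ∷ []) , (begin
    fromℤ -[1+ 0 ] + x * (fromℤ (ℤ.- c₁) + x * (fromℤ (ℤ.- c₂) + x * 1#))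
      ≈⟨ ≈.+-congˡ (≈.*-congˡ (≈.+-cong (fromℤ-homo-neg c₁) (≈.*-congˡ (≈.+-cong (fromℤ-homo-neg c₂) (≈.*-congˡ (≈.sym fromℤ-1)))))) ⟩
    fromℤ -[1+ 0 ] + x * (- fromℤ c₁ + x * (- fromℤ c₂ + x * fromℤ (+ 1)))
      ≈⟨ solve 3 (λ x c₁ c₂ → con -[1+ 0 ] :+ x :* (:- c₁ :+ x :* (:- c₂ :+ x :* con (+ 1)))
                            := x :* x :* x :- (c₂ :* (x :* x) :+ c₁ :* x :+ con (+ 1)))
          (λ {_} {_} {_} → ≈.refl) x (fromℤ c₁) (fromℤ c₂) ⟩
    x * x * x - (fromℤ c₂ * (x * x) + fromℤ c₁ * x + fromℤ (+ 1))
      ≈⟨ ≈.+-congʳ root ⟩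
    fromℤ c₂ * (x * x) + fromℤ c₁ * x + fromℤ (+ 1) - (fromℤ c₂ * (x * x) + fromℤ c₁ * x + fromℤ (+ 1))
      ≈⟨ ≈.-‿inverseʳ _ ⟩
    0# ∎)

  -- The equation of x multiplied by y³, with x y replaced by 1.
  Root-reciprocal : ∀ {x y c₁ c₂} → x * y ≈ fromℤ (+ 1) → Root c₁ c₂ x → Root (- c₂) (- c₁) y
  Root-reciprocal {x} {y} {c₁} {c₂} xy≈1 root = begin
    y * y * y
      ≈⟨ solve 4 (λ x y c₁ c₂ → y :* y :* y :=
          (c₂ :* (x :* x) :+ c₁ :* x :+ con (+ 1)) :* (y :* y :* y)
            :- c₂ :* (x :* y :* (x :* y)) :* y :- c₁ :* (x :* y) :* (y :* y))
          (λ {_} {_} {_} {_} → ≈.refl) x y c₁ c₂ ⟩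
    (c₂ * (x * x) + c₁ * x + fromℤ (+ 1)) * (y * y * y) - c₂ * (x * y * (x * y)) * y - c₁ * (x * y) * (y * y)
      ≈⟨ ≈.+-congʳ (≈.+-congʳ (≈.*-congʳ root)) ⟨
    x * x * x * (y * y * y) - c₂ * (x * y * (x * y)) * y - c₁ * (x * y) * (y * y)
      ≈⟨ ≈.+-congʳ (≈.+-congʳ (solve 2 (λ x y → x :* x :* x :* (y :* y :* y) := x :* y :* (x :* y) :* (x :* y))
          (λ {_} {_} → ≈.refl) x y)) ⟩
    x * y * (x * y) * (x * y) - c₂ * (x * y * (x * y)) * y - c₁ * (x * y) * (y * y)
      ≈⟨ ≈.+-cong (≈.+-cong (≈.*-cong (≈.*-cong xy≈1 xy≈1) xy≈1)
          (≈.-‿cong (≈.*-congʳ (≈.*-congˡ (≈.*-cong xy≈1 xy≈1))))) (≈.-‿cong (≈.*-congʳ (≈.*-congˡ xy≈1))) ⟩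
    u * u * u - c₂ * (u * u) * y - c₁ * u * (y * y)
      ≈⟨ solve 3 (λ y c₁ c₂ → con (+ 1) :* con (+ 1) :* con (+ 1) :- c₂ :* (con (+ 1) :* con (+ 1)) :* y :- c₁ :* con (+ 1) :* (y :* y)
          := (:- c₁) :* (y :* y) :+ (:- c₂) :* y :+ con (+ 1)) (λ {_} {_} {_} → ≈.refl) y c₁ c₂ ⟩
    - c₁ * (y * y) + - c₂ * y + fromℤ (+ 1) ∎
    where u = fromℤ (+ 1)

  -- The equation of y divided by y. For y = s it expresses t in the basis 1, s, s².
  Root-inverse : ∀ {x y c₁ c₂} → x * y ≈ fromℤ (+ 1) → Root c₁ c₂ y → x ≈ y * y - c₂ * y - c₁
  Root-inverse {x} {y} {c₁} {c₂} xy≈1 root = begin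
    x
      ≈⟨ solve 4 (λ x y c₁ c₂ → x :=
          x :* (c₂ :* (y :* y) :+ c₁ :* y :+ con (+ 1)) :- x :* y :* (c₂ :* y :+ c₁))
          (λ {_} {_} {_} {_} → ≈.refl) x y c₁ c₂ ⟩
    x * (c₂ * (y * y) + c₁ * y + fromℤ (+ 1)) - x * y * (c₂ * y + c₁)
      ≈⟨ ≈.+-congʳ (≈.*-congˡ root) ⟨
    x * (y * y * y) - x * y * (c₂ * y + c₁)
      ≈⟨ solve 4 (λ x y c₁ c₂ → x :* (y :* y :* y) :- x :* y :* (c₂ :* y :+ c₁) := x :* y :* (y :* y :- c₂ :* y :- c₁))
          (λ {_} {_} {_} {_} → ≈.refl) x y c₁ c₂ ⟩
    x * y * (y * y - c₂ * y - c₁)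
      ≈⟨ ≈.*-congʳ (≈.trans xy≈1 fromℤ-1) ⟩
    1# * (y * y - c₂ * y - c₁)
      ≈⟨ ≈.*-identityˡ _ ⟩
    y * y - c₂ * y - c₁ ∎

  module Embedding
    (root : evalMonic (-[1+ 0 ] ∷ ℤ.- (a ℤ.+ + 3) ∷ ℤ.- a ∷ []) ρ ≈ 0#)
    (ρ<-1 : ρ < fromℤ -[1+ 0 ])
    where

    t : Carrier
    t = fromℤ -[1+ 0 ] - ρ

    0<t : 0# < t
    0<t = <⇒0<- ρ<-1

    t-root : Root (- α) (- (α + fromℤ (+ 3))) t
    t-root = begin
      t * t * t
        ≈⟨ solve 2 (λ ρ α → let t = con -[1+ 0 ] :- ρ in t :* t :* t :=
              (:- (α :+ con (+ 3))) :* (t :* t) :+ (:- α) :* t :+ con (+ 1)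
              :- (con -[1+ 0 ] :+ ρ :* (:- (α :+ con (+ 3)) :+ ρ :* (:- α :+ ρ :* con (+ 1)))))
            (λ {_} {_} → ≈.refl) ρ α ⟩
      cubic - (fromℤ -[1+ 0 ] + ρ * (- (α + fromℤ (+ 3)) + ρ * (- α + ρ * fromℤ (+ 1))))
        ≈⟨ ≈.+-congˡ (≈.-‿cong (≈.+-congˡ (≈.*-congˡ (≈.+-cong
            (≈.trans (fromℤ-homo-neg (a ℤ.+ + 3)) (≈.-‿cong (fromℤ-homo-+ a (+ 3))))
            (≈.*-congˡ (≈.+-cong (fromℤ-homo-neg a) (≈.*-congˡ (≈.sym fromℤ-1)))))))) ⟨
      cubic - evalMonic (-[1+ 0 ] ∷ ℤ.- (a ℤ.+ + 3) ∷ ℤ.- a ∷ []) ρ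
        ≈⟨ ≈.+-congˡ (≈.-‿cong root) ⟩
      cubic - 0#
        ≈⟨ solve 1 (λ x → x :- con (+ 0) := x) (λ {_} → ≈.refl) cubic ⟩
      cubic ∎
      where cubic = - (α + fromℤ (+ 3)) * (t * t) + - α * t + fromℤ (+ 1)

    t#0 : t # 0#
    t#0 = 0<⇒#0 0<t

    s : Carrier
    s = inv t t#0

    ts≈1 : t * s ≈ 1#
    ts≈1 = inverseʳ t#0

    0<s : 0# < s
    0<s = *-cancel-positive 0<t (<-respʳ (≈.sym ts≈1) 0<1)

    private
      ts≈u : t * s ≈ fromℤ (+ 1)
      ts≈u = ≈.trans ts≈1 (≈.sym fromℤ-1)

    s-root : Root (α + fromℤ (+ 3)) α s
    s-root = ≈.trans (Root-reciprocal ts≈u t-root) (solve 2 (λ α s →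
        (:- :- α) :* (s :* s) :+ (:- :- (α :+ con (+ 3))) :* s :+ con (+ 1)
          := α :* (s :* s) :+ (α :+ con (+ 3)) :* s :+ con (+ 1))
      (λ {_} {_} → ≈.refl) α s)

    value : Elem → Carrier
    value ⟨ p , q , r ⟩ = evalᴿ p + evalᴿ q * s + evalᴿ r * (s * s)

    value-unity : value unity ≈ 1#
    value-unity = ≈.trans (≈.+-congʳ (≈.+-congʳ (evalᴿ-con (+ 1))))
      (≈.trans (solve 1 (λ s → con (+ 1) :+ con (+ 0) :* s :+ con (+ 0) :* (s :* s) := con (+ 1)) (λ {_} → ≈.refl) s) fromℤ-1)

    value-⊕ : ∀ x y → value (x ⊕ y) ≈ value x + value y
    value-⊕ ⟨ p , q , r ⟩ ⟨ p′ , q′ , r′ ⟩ =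
      ≈.trans (≈.+-cong (≈.+-cong (evalᴿ-+ p p′) (≈.*-congʳ (evalᴿ-+ q q′))) (≈.*-congʳ (evalᴿ-+ r r′)))
        (solve 7 (λ p q r p′ q′ r′ s → p :+ p′ :+ (q :+ q′) :* s :+ (r :+ r′) :* (s :* s)
            := p :+ q :* s :+ r :* (s :* s) :+ (p′ :+ q′ :* s :+ r′ :* (s :* s)))
          (λ {_} {_} {_} {_} {_} {_} {_} → ≈.refl) (evalᴿ p) (evalᴿ q) (evalᴿ r) (evalᴿ p′) (evalᴿ q′) (evalᴿ r′) s)

    value-⊖ : ∀ x b y → value (x ⊖[ b ] y) ≈ value x - evalᴿ b * value y
    value-⊖ ⟨ p , q , r ⟩ b ⟨ p′ , q′ , r′ ⟩ =
      ≈.trans (≈.+-cong (≈.+-cong (coefficient p p′) (≈.*-congʳ (coefficient q q′))) (≈.*-congʳ (coefficient r r′)))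
        (solve 8 (λ p q r b p′ q′ r′ s → p :- b :* p′ :+ (q :- b :* q′) :* s :+ (r :- b :* r′) :* (s :* s)
            := p :+ q :* s :+ r :* (s :* s) :- b :* (p′ :+ q′ :* s :+ r′ :* (s :* s)))
          (λ {_} {_} {_} {_} {_} {_} {_} {_} → ≈.refl)
          (evalᴿ p) (evalᴿ q) (evalᴿ r) (evalᴿ b) (evalᴿ p′) (evalᴿ q′) (evalᴿ r′) s)
      where
      coefficient : ∀ p p′ → evalᴿ (p -ₚ b *ₚ p′) ≈ evalᴿ p - evalᴿ b * evalᴿ p′
      coefficient p p′ = ≈.trans (evalᴿ-- p (b *ₚ p′)) (≈.+-congˡ (≈.-‿cong (evalᴿ-* b p′)))

    value-multiply-s : ∀ x → value (multiply-s x) ≈ s * value x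
    value-multiply-s ⟨ p , q , r ⟩ = begin
      evalᴿ r + evalᴿ (p +ₚ (aₚ +ₚ (+ 3 ∷ [])) *ₚ r) * s + evalᴿ (q +ₚ aₚ *ₚ r) * (s * s)
        ≈⟨ ≈.+-cong (≈.+-congˡ (≈.*-congʳ (≈.trans (evalᴿ-+ p _) (≈.+-congˡ (evalᴿ-a+3 r)))))
            (≈.*-congʳ (≈.trans (evalᴿ-+ q _) (≈.+-congˡ (evalᴿ-a* r)))) ⟩
      evalᴿ r + (evalᴿ p + (α + fromℤ (+ 3)) * evalᴿ r) * s + (evalᴿ q + α * evalᴿ r) * (s * s)
        ≈⟨ solve 5 (λ p q r α s → r :+ (p :+ (α :+ con (+ 3)) :* r) :* s :+ (q :+ α :* r) :* (s :* s)
            := s :* (p :+ q :* s) :+ r :* (α :* (s :* s) :+ (α :+ con (+ 3)) :* s :+ con (+ 1)))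
            (λ {_} {_} {_} {_} {_} → ≈.refl) (evalᴿ p) (evalᴿ q) (evalᴿ r) α s ⟩
      s * (evalᴿ p + evalᴿ q * s) + evalᴿ r * (α * (s * s) + (α + fromℤ (+ 3)) * s + fromℤ (+ 1))
        ≈⟨ ≈.+-congˡ (≈.*-congˡ s-root) ⟨
      s * (evalᴿ p + evalᴿ q * s) + evalᴿ r * (s * s * s)
        ≈⟨ solve 4 (λ p q r s → s :* (p :+ q :* s) :+ r :* (s :* s :* s) := s :* (p :+ q :* s :+ r :* (s :* s)))
            (λ {_} {_} {_} {_} → ≈.refl) (evalᴿ p) (evalᴿ q) (evalᴿ r) s ⟩
      s * value ⟨ p , q , r ⟩ ∎

    value-divide-s : ∀ x → value (divide-s x) ≈ t * value x
    value-divide-s ⟨ p , q , r ⟩ = begin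
      evalᴿ (q -ₚ (aₚ +ₚ (+ 3 ∷ [])) *ₚ p) + evalᴿ (r -ₚ aₚ *ₚ p) * s + evalᴿ p * (s * s)
        ≈⟨ ≈.+-congʳ (≈.+-cong (≈.trans (evalᴿ-- q _) (≈.+-congˡ (≈.-‿cong (evalᴿ-a+3 p))))
            (≈.*-congʳ (≈.trans (evalᴿ-- r _) (≈.+-congˡ (≈.-‿cong (evalᴿ-a* p)))))) ⟩
      evalᴿ q - (α + fromℤ (+ 3)) * evalᴿ p + (evalᴿ r - α * evalᴿ p) * s + evalᴿ p * (s * s)
        ≈⟨ solve 5 (λ p q r α s → q :- (α :+ con (+ 3)) :* p :+ (r :- α :* p) :* s :+ p :* (s :* s)
            := (s :* s :- α :* s :- (α :+ con (+ 3))) :* p :+ con (+ 1) :* (q :+ r :* s))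
            (λ {_} {_} {_} {_} {_} → ≈.refl) (evalᴿ p) (evalᴿ q) (evalᴿ r) α s ⟩
      (s * s - α * s - (α + fromℤ (+ 3))) * evalᴿ p + fromℤ (+ 1) * (evalᴿ q + evalᴿ r * s)
        ≈⟨ ≈.+-cong (≈.*-congʳ (Root-inverse ts≈u s-root)) (≈.*-congʳ ts≈u) ⟨
      t * evalᴿ p + t * s * (evalᴿ q + evalᴿ r * s)
        ≈⟨ solve 5 (λ p q r t s → t :* p :+ t :* s :* (q :+ r :* s) := t :* (p :+ q :* s :+ r :* (s :* s)))
            (λ {_} {_} {_} {_} {_} → ≈.refl) (evalᴿ p) (evalᴿ q) (evalᴿ r) t s ⟩
      t * value ⟨ p , q , r ⟩ ∎

    -- Descends from sᵏ x to x by cancelling one positive factor s at a time.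
    value-positive : ∀ k x → T (positiveAfter k x) → 0# < value x
    value-positive zero ⟨ p , q , r ⟩ h =
      +-nonNegative-* (eval-nonNegative r r≥0 m) (*-positive 0<s 0<s)
        (+-nonNegative-* (eval-nonNegative q q≥0 m) 0<s
          (fromℤ-≤-<-trans {i = + 1} (fromℤ-positive 0) (eval-positive p p>0 m)))
      where
      p>0 = proj₁ (T-∧⁻ (positive p) h)
      q≥0 = proj₁ (T-∧⁻ (nonNegative q) (proj₂ (T-∧⁻ (positive p) h)))
      r≥0 = proj₂ (T-∧⁻ (nonNegative q) (proj₂ (T-∧⁻ (positive p) h)))
    value-positive (suc k) x h = *-cancel-positive 0<s (<-respʳ (value-multiply-s x) (value-positive k (multiply-s x) h))

    value³ : Vector → ℝ³
    value³ ⟪ x , y , z ⟫ = value x , value y , value z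

    evalᴰ : Poly × Poly → ℤ × ℤ
    evalᴰ (b , d) = eval b (+ m) , eval d (+ m)

    value³-next : ∀ bd v → value³ (next bd v) ≋ residue (evalᴰ bd) (value³ v)
    value³-next (b , d) ⟪ x , y , z ⟫ = value-⊖ y b x , value-⊖ z d x , ≈.refl

    validStep-positive : ∀ bd v → T (validStep bd v) → 0# < proj₁ (value³ v)
    validStep-positive (b , d) ⟪ x , y , z ⟫ h = value-positive 12 x (proj₁ (T-∧⁻ (positiveElem x) h))

    validStep-digits : ∀ bd v → T (validStep bd v) → Digits (value³ v) (evalᴰ bd)
    validStep-digits (b , d) ⟪ x , y , z ⟫ h = Digits-positive _ _
      (value-positive 12 x (proj₁ h₁)) (proj₁ second) (proj₂ second) (proj₁ third) (proj₂ third)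
      where
      h₁ = T-∧⁻ (positiveElem x) h
      h₂ = T-∧⁻ (positiveElem (y ⊖[ b ] x) ∧ positiveElem (x ⊖[ + 1 ∷ [] ] (y ⊖[ b ] x))) (proj₂ h₁)

      bounds : ∀ y b → T (positiveElem (y ⊖[ b ] x) ∧ positiveElem (x ⊖[ + 1 ∷ [] ] (y ⊖[ b ] x))) →
        0# < value y - evalᴿ b * value x × 0# < value x - (value y - evalᴿ b * value x)
      bounds y b h =
        <-respʳ (value-⊖ y b x) (value-positive 12 (y ⊖[ b ] x) (proj₁ (T-∧⁻ (positiveElem (y ⊖[ b ] x)) h))) ,
        <-respʳ (≈.trans (value-⊖ x (+ 1 ∷ []) (y ⊖[ b ] x)) (≈.+-congˡ (≈.-‿cong
            (≈.trans (≈.*-congʳ (≈.trans (evalᴿ-con (+ 1)) fromℤ-1)) (≈.trans (≈.*-identityˡ _) (value-⊖ y b x))))))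
          (value-positive 12 (x ⊖[ + 1 ∷ [] ] (y ⊖[ b ] x)) (proj₂ (T-∧⁻ (positiveElem (y ⊖[ b ] x)) h)))

      second = bounds y b (proj₁ h₂)
      third = bounds z d (proj₂ h₂)

    equalElem-value : ∀ x y → T (equalElem x y) → value x ≈ value y
    equalElem-value ⟨ p , q , r ⟩ ⟨ p′ , q′ , r′ ⟩ h =
      ≈.+-cong (≈.+-cong (equal p p′ (proj₁ h₁)) (≈.*-congʳ (equal q q′ (proj₁ h₂)))) (≈.*-congʳ (equal r r′ (proj₂ h₂)))
      where
      h₁ = T-∧⁻ (zero? (p -ₚ p′)) h
      h₂ = T-∧⁻ (zero? (q -ₚ q′)) (proj₂ h₁)
      equal : ∀ p q → T (zero? (p -ₚ q)) → evalᴿ p ≈ evalᴿ q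
      equal p q z = fromℤ-cong (eval-≡ p q z (+ m))

    θ η : Carrier
    θ = s + s * s
    η = θ * θ

    value-multiply-s+s² : ∀ x → value (multiply-s+s² x) ≈ θ * value x
    value-multiply-s+s² x = begin
      value (multiply-s (x ⊕ multiply-s x))    ≈⟨ value-multiply-s (x ⊕ multiply-s x) ⟩
      s * value (x ⊕ multiply-s x)             ≈⟨ ≈.*-congˡ (≈.trans (value-⊕ x (multiply-s x)) (≈.+-congˡ (value-multiply-s x))) ⟩
      s * (value x + s * value x)              ≈⟨ solve 2 (λ s x → s :* (x :+ s :* x) := (s :+ s :* s) :* x) (λ {_} {_} → ≈.refl) s (value x) ⟩
      θ * value x                              ∎

    multiple-value : ∀ v w → T (multiple v w) → value³ w ≋ η ⊙ value³ v
    multiple-value ⟪ x , y , z ⟫ ⟪ x′ , y′ , z′ ⟫ h = times-η x x′ (proj₁ h₁) , times-η y y′ (proj₁ h₂) , times-η z z′ (proj₂ h₂)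
      where
      h₁ = T-∧⁻ (equalElem (multiply-s+s² (multiply-s+s² x)) x′) h
      h₂ = T-∧⁻ (equalElem (multiply-s+s² (multiply-s+s² y)) y′) (proj₂ h₁)
      times-η : ∀ x x′ → T (equalElem (multiply-s+s² (multiply-s+s² x)) x′) → value x′ ≈ η * value x
      times-η x x′ h = begin
        value x′                                   ≈⟨ equalElem-value (multiply-s+s² (multiply-s+s² x)) x′ h ⟨
        value (multiply-s+s² (multiply-s+s² x))    ≈⟨ value-multiply-s+s² (multiply-s+s² x) ⟩
        θ * value (multiply-s+s² x)                ≈⟨ ≈.*-congˡ (value-multiply-s+s² x) ⟩
        θ * (θ * value x)                          ≈⟨ ≈.*-assoc θ θ (value x) ⟨
        η * value x                                ∎

    0<η : 0# < η
    0<η = *-positive 0<θ 0<θ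
      where 0<θ = +-positive 0<s (*-positive 0<s 0<s)

    η#0 : η # 0#
    η#0 = 0<⇒#0 0<η

    ε : Carrier
    ε = inv η η#0

    ηε≈1 : η * ε ≈ 1#
    ηε≈1 = inverseʳ η#0

    0<ε : 0# < ε
    0<ε = *-cancel-positive 0<η (<-respʳ (≈.sym ηε≈1) 0<1)

    private
      b c₁ c₂ : ℤ
      b  = a ℤ.* a ℤ.+ + 3 ℤ.* a ℤ.+ + 6
      c₁ = ℤ.- (+ 9 ℤ.+ + 2 ℤ.* b)
      c₂ = b ℤ.* b ℤ.- + 6

      B : Carrier
      B = fromℤ b

      fromℤ-b : B ≈ α * α + fromℤ (+ 3) * α + fromℤ (+ 6)
      fromℤ-b = ≈.trans (fromℤ-homo-+ (a ℤ.* a ℤ.+ + 3 ℤ.* a) (+ 6)) (≈.+-congʳ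
        (≈.trans (fromℤ-homo-+ (a ℤ.* a) (+ 3 ℤ.* a)) (≈.+-cong (fromℤ-homo-* a a) (fromℤ-homo-* (+ 3) a))))

      fromℤ-c₁ : fromℤ c₁ ≈ - (fromℤ (+ 9) + fromℤ (+ 2) * B)
      fromℤ-c₁ = ≈.trans (fromℤ-homo-neg (+ 9 ℤ.+ + 2 ℤ.* b)) (≈.-‿cong
        (≈.trans (fromℤ-homo-+ (+ 9) (+ 2 ℤ.* b)) (≈.+-congˡ (fromℤ-homo-* (+ 2) b))))

      fromℤ-c₂ : fromℤ c₂ ≈ B * B - fromℤ (+ 6)
      fromℤ-c₂ = ≈.trans (fromℤ-homo-- (b ℤ.* b) (+ 6)) (≈.+-congʳ (fromℤ-homo-* b b))

    -- B is the trace of θ. As s + s² is invariant under s ↦ -1 - s, the cubic of θ, written in s,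
    -- is divisible by f(s) and by f(-1 - s); the cofactor is -f(-1 - s).
    θ-root : θ * θ * θ + fromℤ (+ 3) * θ + fromℤ (+ 1) - B * (θ * θ) ≈ 0#
    θ-root = begin
      θ * θ * θ + fromℤ (+ 3) * θ + fromℤ (+ 1) - B * (θ * θ)
        ≈⟨ ≈.+-congˡ (≈.-‿cong (≈.*-congʳ fromℤ-b)) ⟩
      θ * θ * θ + fromℤ (+ 3) * θ + fromℤ (+ 1) - (α * α + fromℤ (+ 3) * α + fromℤ (+ 6)) * (θ * θ)
        ≈⟨ solve 2 (λ α s → let θ = s :+ s :* s in
              θ :* θ :* θ :+ con (+ 3) :* θ :+ con (+ 1) :- (α :* α :+ con (+ 3) :* α :+ con (+ 6)) :* (θ :* θ)
              := (s :* s :* s :- (α :* (s :* s) :+ (α :+ con (+ 3)) :* s :+ con (+ 1)))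
                 :* (s :* s :* s :+ (con (+ 3) :+ α) :* (s :* s) :+ α :* s :- con (+ 1)))
            (λ {_} {_} → ≈.refl) α s ⟩
      (s * s * s - (α * (s * s) + (α + fromℤ (+ 3)) * s + fromℤ (+ 1))) * cofactor
        ≈⟨ ≈.*-congʳ (≈.trans (≈.+-congʳ s-root) (≈.-‿inverseʳ _)) ⟩
      0# * cofactor
        ≈⟨ ≈.zeroˡ cofactor ⟩
      0# ∎
      where cofactor = s * s * s + (fromℤ (+ 3) + α) * (s * s) + α * s - fromℤ (+ 1)

    -- If P is the cubic of θ, then -P(θ) P(-θ) is even in θ and is the cubic of η = θ². The
    -- cofactor is -P(-θ).
    η-root : Root (fromℤ c₁) (fromℤ c₂) η
    η-root = begin
      η * η * η
        ≈⟨ solve 2 (λ θ b → let η = θ :* θ in η :* η :* η :=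
              (b :* b :- con (+ 6)) :* (η :* η) :+ (:- (con (+ 9) :+ con (+ 2) :* b)) :* η :+ con (+ 1)
              :+ (θ :* θ :* θ :+ con (+ 3) :* θ :+ con (+ 1) :- b :* (θ :* θ))
                 :* (θ :* θ :* θ :+ con (+ 3) :* θ :- con (+ 1) :+ b :* (θ :* θ)))
            (λ {_} {_} → ≈.refl) θ B ⟩
      (B * B - fromℤ (+ 6)) * (η * η) + - (fromℤ (+ 9) + fromℤ (+ 2) * B) * η + fromℤ (+ 1)
        + (θ * θ * θ + fromℤ (+ 3) * θ + fromℤ (+ 1) - B * (θ * θ)) * cofactor
        ≈⟨ ≈.+-cong (≈.+-congʳ (≈.+-cong (≈.*-congʳ fromℤ-c₂) (≈.*-congʳ fromℤ-c₁)))
            (≈.trans (≈.sym (≈.zeroˡ cofactor)) (≈.*-congʳ (≈.sym θ-root))) ⟨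
      fromℤ c₂ * (η * η) + fromℤ c₁ * η + fromℤ (+ 1) + 0#
        ≈⟨ ≈.+-identityʳ _ ⟩
      fromℤ c₂ * (η * η) + fromℤ c₁ * η + fromℤ (+ 1) ∎
      where cofactor = θ * θ * θ + fromℤ (+ 3) * θ - fromℤ (+ 1) + B * (θ * θ)

    ε-integral : AlgebraicInteger ε
    ε-integral = Root-integral (ℤ.- c₂) (ℤ.- c₁) (≈.trans
      (Root-reciprocal (≈.trans ηε≈1 (≈.sym fromℤ-1)) η-root)
      (≈.+-congʳ (≈.+-cong (≈.*-congʳ (≈.sym (fromℤ-homo-neg c₁))) (≈.*-congʳ (≈.sym (fromℤ-homo-neg c₂))))))

    -- Stated for any vector with second entry -ρ, because periodicity refers to the field of β 0,
    -- which agrees with the initial vector only up to `≋`.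
    ε-unit : ∀ v → proj₁ (proj₂ v) ≈ - ρ → Unit v ε
    ε-unit v v₂≈-ρ = (ε∈ , ε-integral) , η , (η∈ , Root-integral c₁ c₂ η-root) , ≈.trans (≈.*-comm ε η) ηε≈1
      where
      t∈ : ℚ⟨ v ⟩ t
      t∈ = resp (≈.+-cong (≈.-‿cong (≈.sym fromℤ-1)) v₂≈-ρ) (add (neg one) entry₂)
      s∈ : ℚ⟨ v ⟩ s
      s∈ = recip t#0 t∈
      η∈ : ℚ⟨ v ⟩ η
      η∈ = mul (add s∈ (mul s∈ s∈)) (add s∈ (mul s∈ s∈))
      ε∈ : ℚ⟨ v ⟩ ε
      ε∈ = recip η#0 η∈

-- The closed formulas in ρ.

byParity : ∀ {ℓ} {X : Set ℓ} → Fin 2 → X → X → X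
byParity 0F even odd = even
byParity 1F even odd = odd

module Formulas (δ : Fin 2) where
  open +-*-Solver using (Polynomial; op; [+]; [*]; con; var; _:^_; :-_; _:+_; _:-_; _:*_; ⟦_⟧)
  open CubicOrder δ using (digits)

  toPoly : Polynomial 1 → Poly
  toPoly (op [+] e f) = toPoly e +ₚ toPoly f
  toPoly (op [*] e f) = toPoly e *ₚ toPoly f
  toPoly (con c)      = c ∷ []
  toPoly (var 0F)     = + 0 ∷ + 1 ∷ []
  toPoly (e :^ zero)  = + 1 ∷ []
  toPoly (e :^ suc n) = toPoly e *ₚ toPoly (e :^ n)
  toPoly (:- e)       = scale ℤ.-1ℤ (toPoly e)

  eval-toPoly : ∀ e x → eval (toPoly e) x ≡ ⟦ e ⟧ (x Vec.∷ Vec.[])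
  eval-toPoly (op [+] e f) x = ≡.trans (eval-+ (toPoly e) (toPoly f) x) (≡.cong₂ ℤ._+_ (eval-toPoly e x) (eval-toPoly f x))
  eval-toPoly (op [*] e f) x = ≡.trans (eval-* (toPoly e) (toPoly f) x) (≡.cong₂ ℤ._*_ (eval-toPoly e x) (eval-toPoly f x))
  eval-toPoly (con c)      x = ≡.trans (≡.cong (λ z → c ℤ.+ z) (ℤ.*-zeroʳ x)) (ℤ.+-identityʳ c)
  eval-toPoly (var 0F)     x = ≡.trans (ℤ.+-identityˡ _) (≡.trans
    (≡.cong (λ z → x ℤ.* (+ 1 ℤ.+ z)) (ℤ.*-zeroʳ x)) (ℤ.*-identityʳ x))
  eval-toPoly (e :^ zero)  x = ≡.cong (λ z → + 1 ℤ.+ z) (ℤ.*-zeroʳ x)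
  eval-toPoly (e :^ suc n) x = ≡.trans (eval-* (toPoly e) (toPoly (e :^ n)) x) (≡.cong₂ ℤ._*_ (eval-toPoly e x) (eval-toPoly (e :^ n) x))
  eval-toPoly (:- e)       x = ≡.trans (eval-scale ℤ.-1ℤ (toPoly e) x) (≡.trans (ℤ.-1*i≡-i _) (≡.cong ℤ.-_ (eval-toPoly e x)))

  -- Coefficients of 1, ρ, ρ² as solver syntax: evaluated at m they unfold to the expressions of the
  -- theorem, while `toPoly` turns them into lists whose equality can be computed.
  Formula : Set
  Formula = Polynomial 1 × Polynomial 1 × Polynomial 1

  A a : Polynomial 1
  A = con (+ 2) :+ var 0F
  a = con (+ toℕ δ) :+ A :* con (+ 2)

  first second third : ℕ → Formula
  first 0 = con 1 , con 0 , con 0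
  first 1 = :- con 1 , :- con 1 , con 0
  first 2 = con 1 , con 2 , con 1
  first 3 = a :+ con 1 , a :- con 1 , :- con 1
  first 4 = :- (a :+ con 2) , :- (con 2 :* a :+ con 3) , :- (a :+ con 1)
  first 5 = :- a , :- (a :- con 3) , con 2
  -- For even a this is `second 5`, since the digit δ at position 5 vanishes; for odd a, `first 5`
  -- is subtracted once.
  first 6 = byParity δ
    (con 2 :* A :^ 2 :+ con 4 :* A :+ con 1 , con 4 :* A :^ 2 :+ con 5 :* A :- con 1 , con 2 :* A :^ 2 :+ A :- con 1)
    (con 2 :* A :^ 2 :+ con 7 :* A :+ con 3 , con 4 :* A :^ 2 :+ con 9 :* A :- con 2 , con 2 :* A :^ 2 :+ con 2 :* A :- con 3)
  first 7 = a :- con 2 , :- con 9 , :- (a :+ con 5)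
  -- Position 8, and by default everything beyond; the formulas are used up to 8 only.
  first _ = :- (a :^ 2) :- con 5 , :- (a :^ 2 :- a :+ con 14) , :- con 7

  second 0 = con 0 , :- con 1 , con 0
  second 1 = :- con 1 , con 0 , con 1
  second 2 = a :+ con 2 , a :+ con 1 , con 0
  second 3 = :- (a :+ con 2) , :- (con 2 :* a :+ con 3) , :- (a :+ con 1)
  second 4 = :- a , :- (a :- con 3) , con 2
  second 5 = byParity δ
    (con 2 :* A :^ 2 :+ con 4 :* A :+ con 1 , con 4 :* A :^ 2 :+ con 5 :* A :- con 1 , con 2 :* A :^ 2 :+ A :- con 1)
    (con 2 :* A :^ 2 :+ con 5 :* A :+ con 2 , con 4 :* A :^ 2 :+ con 7 :* A , con 2 :* A :^ 2 :+ con 2 :* A :- con 1)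
  second 6 = a :- con 2 , :- con 9 , :- (a :+ con 5)
  second 7 = byParity δ
    (:- (con 2 :* A :^ 2) :- con 6 :* A :- con 1 , :- (con 4 :* A :^ 2 :+ con 7 :* A :- con 4) , :- (con 2 :* A :^ 2 :+ A :- con 3))
    (:- (con 2 :* A :^ 2) :- con 9 :* A :- con 4 , :- (con 4 :* A :^ 2 :+ con 11 :* A :- con 4) , :- (con 2 :* A :^ 2 :+ con 2 :* A :- con 5))
  second _ = con 7 , a :^ 2 :+ con 7 :* a :+ con 26 , a :^ 2 :+ con 6 :* a :+ con 14

  third zero    = con 0 , con 0 , con 1
  third (suc k) = first k

  isResidue : Poly → Formula → Formula → Formula → Bool
  isResidue b (p , q , r) (p′ , q′ , r′) (p″ , q″ , r″) = coefficient p p′ p″ ∧ coefficient q q′ q″ ∧ coefficient r r′ r″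
    where
    coefficient : (p p′ p″ : Polynomial 1) → Bool
    coefficient p p′ p″ = zero? ((toPoly p -ₚ b *ₚ toPoly p′) -ₚ toPoly p″)

  -- A step is linear with integer digits, so it acts on the coefficients of 1, ρ and ρ² separately.
  -- The new third entry is the old first one by definition of `third`.
  formulaStep : ℕ → Bool
  formulaStep k = isResidue (digits k .proj₁) (second k) (first k) (first (suc k))
                ∧ isResidue (digits k .proj₂) (third k) (first k) (second (suc k))

formulaStep-holds : ∀ δ {k} → k ℕ.< 8 → T (Formulas.formulaStep δ k)
formulaStep-holds 0F = toWitness {a? = ℕ.allUpTo? (λ k → T? (Formulas.formulaStep 0F k)) 8} tt
formulaStep-holds 1F = toWitness {a? = ℕ.allUpTo? (λ k → T? (Formulas.formulaStep 1F k)) 8} tt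

-- The explicit expansion, its period and the minimality of the lengths.

module CubicExpansion
  {c ℓ₁ ℓ₂ ℓ₃ : Level} (ℝ : Reals c ℓ₁ ℓ₂ ℓ₃) (δ : Fin 2) (m : ℕ) (ρ : Reals.Carrier ℝ)
  where
  open CubicOrder δ using (next; validStep) renaming (digits to digitsₚ; -ρ to -ρᴱ; ρ² to ρ²ᴱ; unity to unityᴱ; divide-s to divide-sᴱ)
  open Reals ℝ using
    (Carrier; _≈_; _+_; _*_; _-_; -_; 0#; 1#; commutativeRing; _<_; *-positive; fromℤ)
  open JacobiPerron ℝ
  open RealArithmetic ℝ
  open Expansions ℝ
  open SimplestCubic ℝ δ m ρ
  private module ≈ = CommutativeRing commutativeRing
  open import Relation.Binary.Reasoning.Setoid ≈.setoid

  module Cycle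
    (root : evalMonic (-[1+ 0 ] ∷ ℤ.- (a ℤ.+ + 3) ∷ ℤ.- a ∷ []) ρ ≈ 0#)
    (ρ<-1 : ρ < fromℤ -[1+ 0 ])
    where
    open Embedding root ρ<-1

    v : ℝ³
    v = 1# , - ρ , ρ * ρ

    private
      value--ρ : value -ρᴱ ≈ - ρ
      value--ρ = begin
        value -ρᴱ                             ≈⟨ value-⊕ unityᴱ (divide-sᴱ unityᴱ) ⟩
        value unityᴱ + value (divide-sᴱ unityᴱ)  ≈⟨ ≈.+-congˡ (value-divide-s unityᴱ) ⟩
        value unityᴱ + t * value unityᴱ       ≈⟨ ≈.+-cong value-unity′ (≈.*-congˡ value-unity′) ⟩
        fromℤ (+ 1) + t * fromℤ (+ 1)         ≈⟨ solve 1 (λ ρ → con (+ 1) :+ (con -[1+ 0 ] :- ρ) :* con (+ 1) := :- ρ) (λ {_} → ≈.refl) ρ ⟩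
        - ρ                                   ∎
        where value-unity′ = ≈.trans value-unity (≈.sym fromℤ-1)

      value-ρ² : value ρ²ᴱ ≈ ρ * ρ
      value-ρ² = begin
        value ρ²ᴱ                             ≈⟨ value-⊕ -ρᴱ (divide-sᴱ -ρᴱ) ⟩
        value -ρᴱ + value (divide-sᴱ -ρᴱ)     ≈⟨ ≈.+-congˡ (value-divide-s -ρᴱ) ⟩
        value -ρᴱ + t * value -ρᴱ             ≈⟨ ≈.+-cong value--ρ (≈.*-congˡ value--ρ) ⟩
        - ρ + t * - ρ                         ≈⟨ solve 1 (λ ρ → :- ρ :+ (con -[1+ 0 ] :- ρ) :* :- ρ := ρ :* ρ) (λ {_} → ≈.refl) ρ ⟩
        ρ * ρ                                 ∎

    multiple-ε : ∀ v w → T (CubicOrder.multiple δ v w) → value³ v ≋ ε ⊙ value³ w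
    multiple-ε v w h = let (p , q , r) = multiple-value v w h in coordinate p , coordinate q , coordinate r
      where
      coordinate : ∀ {x y} → y ≈ η * x → x ≈ ε * y
      coordinate {x} {y} y≈ηx = begin
        x              ≈⟨ ≈.*-identityˡ x ⟨
        1# * x         ≈⟨ ≈.*-congʳ ηε≈1 ⟨
        η * ε * x      ≈⟨ solve 3 (λ η ε x → η :* ε :* x := ε :* (η :* x)) (λ {_} {_} {_} → ≈.refl) η ε x ⟩
        ε * (η * x)    ≈⟨ ≈.*-congˡ y≈ηx ⟨
        ε * y          ∎

    digitsℤ : ℕ → ℤ × ℤ
    digitsℤ k = evalᴰ (digitsₚ k)

    -- `positive-head` is carried along because a vector scaled by ε > 0 must again have a first
    -- entry apart from zero.
    record StepAt (bd : ℤ × ℤ) (x x′ : ℝ³) : Set (ℓ₁ ⊔ ℓ₂ ⊔ ℓ₃) where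
      constructor stepAt
      field
        positive-head : 0# < proj₁ x
        has-digits    : Digits x bd
        is-residue    : x′ ≋ residue bd x
    open StepAt

    -- Opaque, since otherwise the polynomials in `vector` are unfolded over and over during unification.
    opaque
      iteration : ℕ → ℝ³
      iteration k = value³ (CubicOrder.vector δ k)

      iteration-0 : iteration 0 ≋ v
      iteration-0 = value-unity , value--ρ , value-ρ²

      iteration-closes : ∀ j k → Closes δ j k → iteration j ≋ ε ⊙ iteration k
      iteration-closes j k (closed h) = multiple-ε (CubicOrder.vector δ j) (CubicOrder.vector δ k) h

      iteration-step : (k : Fin 9) → StepAt (digitsℤ (toℕ k)) (iteration (toℕ k)) (iteration (suc (toℕ k)))
      iteration-step k = validStep-at (digitsₚ (toℕ k)) (CubicOrder.vector δ (toℕ k)) (validStep-holds δ k)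
        where
        validStep-at : ∀ bd v → T (validStep bd v) → StepAt (evalᴰ bd) (value³ v) (value³ (next bd v))
        validStep-at bd v h = stepAt (validStep-positive bd v h) (validStep-digits bd v h) (value³-next bd v)

    -- Continued beyond position 8 by the factor ε, so that periodicity holds by definition. The
    -- only seam is the step from 8 to 9, which `closes` repairs.
    γ : ℕ → ℝ³
    γ 0 = iteration 0
    γ 1 = iteration 1
    γ 2 = iteration 2
    γ 3 = iteration 3
    γ 4 = iteration 4
    γ 5 = iteration 5
    γ 6 = iteration 6
    γ 7 = iteration 7
    γ 8 = iteration 8
    γ (suc (suc (suc (suc (suc (suc (suc (suc (suc k))))))))) = ε ⊙ γ (suc (suc k))

    γ-step : ∀ k → StepAt (digitsℤ k) (γ k) (γ (suc k))
    γ-step 0 = iteration-step 0F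
    γ-step 1 = iteration-step 1F
    γ-step 2 = iteration-step 2F
    γ-step 3 = iteration-step 3F
    γ-step 4 = iteration-step 4F
    γ-step 5 = iteration-step 5F
    γ-step 6 = iteration-step 6F
    γ-step 7 = iteration-step 7F
    γ-step 8 = let (stepAt 0<x ds x′≋) = iteration-step 8F in stepAt 0<x ds (≋-trans (≋-sym (iteration-closes 9 2 (closes δ))) x′≋)
    γ-step (suc (suc (suc (suc (suc (suc (suc (suc (suc k))))))))) =
      let (stepAt 0<x ds x′≋) = γ-step (suc (suc k)) ; 0<εx = *-positive 0<ε 0<x in
      stepAt 0<εx (Digits-scale (0<⇒#0 0<εx) ≋-refl ds)
        (≋-trans (⊙-cong ε x′≋) (≋-sym (residue-scale (digitsℤ (suc (suc k))) ≋-refl)))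

    γ-expansion : IsExpansion v γ
    γ-expansion = iteration-0 , λ k → step (digitsℤ k) (has-digits (γ-step k)) (is-residue (γ-step k))

    γ-periodic : ∀ k → 2 ℕ.≤ k → γ (k ℕ.+ 7) ≋ ε ⊙ γ k
    γ-periodic (suc (suc k)) (s≤s (s≤s z≤n)) = ≋-reflexive (≡.cong γ (ℕ.+-comm (suc (suc k)) 7))

    thirdDigit : ℕ → ℤ
    thirdDigit k = proj₂ (digitsℤ k)

    -- Digits depend only on ratios of entries, so the unknown factor of a hypothetical period drops
    -- out.
    thirdDigit-scale : ∀ {e} j k → γ j ≋ e ⊙ γ k → thirdDigit j ≡ thirdDigit k
    thirdDigit-scale j k eq = ≡.cong proj₂ (Digits-unique eq (has-digits (γ-step j)) (has-digits (γ-step k)))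

    thirdDigit-≢ : (k : Fin 8) → ¬ (thirdDigit (toℕ k) ≡ thirdDigit 8)
    thirdDigit-≢ k eq with ℤ.≤-trans (eval-positive (digitsₚ 8 .proj₂ -ₚ digitsₚ (toℕ k) .proj₂) (thirdDigit-maximal δ k) m)
      (ℤ.≤-reflexive (≡.trans (eval-- (digitsₚ 8 .proj₂) (digitsₚ (toℕ k) .proj₂) (+ m)) (ℤ.i≡j⇒i-j≡0 (≡.sym eq))))
    ... | ℤ.+≤+ ()

    thirdDigit-8+7j : ∀ j → thirdDigit (8 ℕ.+ j ℕ.* 7) ≡ thirdDigit 8
    thirdDigit-8+7j zero    = refl
    thirdDigit-8+7j (suc j) = thirdDigit-8+7j j

    thirdDigit-8⁻ : ∀ k → thirdDigit k ≡ thirdDigit 8 → ∃[ j ] k ≡ 8 ℕ.+ j ℕ.* 7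
    thirdDigit-8⁻ 0 eq = ⊥-elim (thirdDigit-≢ 0F eq)
    thirdDigit-8⁻ 1 eq = ⊥-elim (thirdDigit-≢ 1F eq)
    thirdDigit-8⁻ 2 eq = ⊥-elim (thirdDigit-≢ 2F eq)
    thirdDigit-8⁻ 3 eq = ⊥-elim (thirdDigit-≢ 3F eq)
    thirdDigit-8⁻ 4 eq = ⊥-elim (thirdDigit-≢ 4F eq)
    thirdDigit-8⁻ 5 eq = ⊥-elim (thirdDigit-≢ 5F eq)
    thirdDigit-8⁻ 6 eq = ⊥-elim (thirdDigit-≢ 6F eq)
    thirdDigit-8⁻ 7 eq = ⊥-elim (thirdDigit-≢ 7F eq)
    thirdDigit-8⁻ 8 _  = 0 , refl
    thirdDigit-8⁻ (suc (suc (suc (suc (suc (suc (suc (suc (suc k))))))))) eq =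
      let (j , eq′) = thirdDigit-8⁻ (suc (suc k)) eq in suc j , ≡.cong (7 ℕ.+_) eq′

    module _ (β : ℕ → ℝ³) (β-expansion : IsExpansion v β) where

      β≋γ : ∀ k → β k ≋ γ k
      β≋γ = expansion-unique β-expansion γ-expansion

      β-periodic : IsPeriodic β 2 7
      β-periodic = s≤s z≤n , ε , ε-unit (β 0) (proj₁ (proj₂ (proj₁ β-expansion))) ,
        λ k 2≤k → ≋-trans (β≋γ (k ℕ.+ 7)) (≋-trans (γ-periodic k 2≤k) (⊙-cong ε (≋-sym (β≋γ k))))

      module _ (m₀ m₁ : ℕ) (periodic : IsPeriodic β m₀ m₁) where
        private
          1≤m₁ = proj₁ periodic
          e = proj₁ (proj₂ periodic)

        thirdDigit-periodic : ∀ k → m₀ ℕ.≤ k → thirdDigit (k ℕ.+ m₁) ≡ thirdDigit k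
        thirdDigit-periodic k m₀≤k = thirdDigit-scale (k ℕ.+ m₁) k (≋-trans (≋-sym (β≋γ (k ℕ.+ m₁)))
          (≋-trans (proj₂ (proj₂ (proj₂ periodic)) k m₀≤k) (⊙-cong e (β≋γ k))))

        thirdDigit-multiple : ∀ i k → m₀ ℕ.≤ k → thirdDigit (i ℕ.* m₁ ℕ.+ k) ≡ thirdDigit k
        thirdDigit-multiple zero    k m₀≤k = refl
        thirdDigit-multiple (suc i) k m₀≤k = ≡.trans
          (≡.cong thirdDigit (≡.trans (ℕ.+-assoc m₁ (i ℕ.* m₁) k) (ℕ.+-comm m₁ (i ℕ.* m₁ ℕ.+ k))))
          (≡.trans (thirdDigit-periodic (i ℕ.* m₁ ℕ.+ k) (ℕ.≤-trans m₀≤k (ℕ.m≤n+m k (i ℕ.* m₁)))) (thirdDigit-multiple i k m₀≤k))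

        -- Position 8 + 7 m₀ is at least m₀ and carries the maximal digit. So does its shift by m₁,
        -- which is therefore some 8 + 7 j; hence 7 divides m₁, and m₁ ≥ 1.
        7≤m₁ : 7 ℕ.≤ m₁
        7≤m₁ = let (j , eq) = thirdDigit-8⁻ (8 ℕ.+ m₀ ℕ.* 7 ℕ.+ m₁) (≡.trans
                     (thirdDigit-periodic (8 ℕ.+ m₀ ℕ.* 7) (ℕ.≤-trans (ℕ.m≤m*n m₀ 7) (ℕ.m≤n+m (m₀ ℕ.* 7) 8)))
                     (thirdDigit-8+7j m₀)) in
          ℕ.∣⇒≤ {{ℕ.>-nonZero 1≤m₁}} (ℕ.∣m+n∣m⇒∣n
            (≡.subst (7 ℕ.∣_) (≡.sym (ℕ.+-cancelˡ-≡ 8 (m₀ ℕ.* 7 ℕ.+ m₁) (j ℕ.* 7) eq)) (ℕ.n∣m*n j)) (ℕ.n∣m*n m₀))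

        -- If m₀ ≤ 1, position 1 shares its digit with 1 + 7 m₁ = 8 + 7 (m₁ - 1), where the digit is
        -- maximal. Taking seven periods makes the position 1 modulo 7 whatever m₁ is.
        2≤m₀ : 2 ℕ.≤ m₀
        2≤m₀ = ℕ.≮⇒≥ λ m₀<2 →
          thirdDigit-≢ 1F (≡.trans (≡.sym (thirdDigit-multiple 7 1 (ℕ.≤-pred m₀<2))) (maximal m₁ 1≤m₁))
          where
          maximal : ∀ n → 1 ℕ.≤ n → thirdDigit (7 ℕ.* n ℕ.+ 1) ≡ thirdDigit 8
          maximal (suc n) _ = ≡.trans
            (≡.cong thirdDigit (≡.trans (ℕ.+-comm (7 ℕ.* suc n) 1) (≡.cong suc (ℕ.*-comm 7 (suc n)))))
            (thirdDigit-8+7j n)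

      β-lengths : PeriodicWithLengths β 2 7
      β-lengths = β-periodic , λ m₀ m₁ periodic → 2≤m₀ m₀ m₁ periodic , 7≤m₁ m₀ m₁ periodic

      open +-*-Solver using (Polynomial) renaming (⟦_⟧ to ⟦_⟧ₑ)
      open Formulas δ using (Formula; toPoly; eval-toPoly; isResidue; first; second; third) 

      ⟦_⟧ : Formula → Carrier
      ⟦ p , q , r ⟧ = quadratic ρ (⟦ p ⟧ₑ (+ m Vec.∷ Vec.[])) (⟦ q ⟧ₑ (+ m Vec.∷ Vec.[])) (⟦ r ⟧ₑ (+ m Vec.∷ Vec.[]))

      ⟦⟧-residue : ∀ b f g h → T (isResidue b f g h) → ⟦ f ⟧ - evalᴿ b * ⟦ g ⟧ ≈ ⟦ h ⟧
      ⟦⟧-residue b f@(p , q , r) g@(p′ , q′ , r′) h@(p″ , q″ , r″) ok = ≈.trans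
        (solve 8 (λ p q r p′ q′ r′ b ρ → p :+ q :* ρ :+ r :* (ρ :* ρ) :- b :* (p′ :+ q′ :* ρ :+ r′ :* (ρ :* ρ))
            := p :- b :* p′ :+ (q :- b :* q′) :* ρ :+ (r :- b :* r′) :* (ρ :* ρ))
          (λ {_} {_} {_} {_} {_} {_} {_} {_} → ≈.refl) (ℤ⟦ p ⟧) (ℤ⟦ q ⟧) (ℤ⟦ r ⟧) (ℤ⟦ p′ ⟧) (ℤ⟦ q′ ⟧) (ℤ⟦ r′ ⟧) (evalᴿ b) ρ)
        (≈.+-cong (≈.+-cong (coefficient p p′ p″ (proj₁ h₁)) (≈.*-congʳ (coefficient q q′ q″ (proj₁ h₂))))
          (≈.*-congʳ (coefficient r r′ r″ (proj₂ h₂))))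
        where
        check : Polynomial 1 → Polynomial 1 → Polynomial 1 → Bool
        check p p′ p″ = zero? ((toPoly p -ₚ b *ₚ toPoly p′) -ₚ toPoly p″)
        h₁ = T-∧⁻ (check p p′ p″) ok
        h₂ = T-∧⁻ (check q q′ q″) (proj₂ h₁)
        ℤ⟦_⟧ : Polynomial 1 → Carrier
        ℤ⟦ e ⟧ = fromℤ (⟦ e ⟧ₑ (+ m Vec.∷ Vec.[]))
        evalᴿ-toPoly : ∀ e → evalᴿ (toPoly e) ≈ ℤ⟦ e ⟧
        evalᴿ-toPoly e = fromℤ-cong (eval-toPoly e (+ m))
        coefficient : ∀ p p′ p″ → T (check p p′ p″) → ℤ⟦ p ⟧ - evalᴿ b * ℤ⟦ p′ ⟧ ≈ ℤ⟦ p″ ⟧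
        coefficient p p′ p″ h = begin
          ℤ⟦ p ⟧ - evalᴿ b * ℤ⟦ p′ ⟧
            ≈⟨ ≈.+-cong (evalᴿ-toPoly p) (≈.-‿cong (≈.*-congˡ (evalᴿ-toPoly p′))) ⟨
          evalᴿ (toPoly p) - evalᴿ b * evalᴿ (toPoly p′)
            ≈⟨ ≈.+-congˡ (≈.-‿cong (evalᴿ-* b (toPoly p′))) ⟨
          evalᴿ (toPoly p) - evalᴿ (b *ₚ toPoly p′)
            ≈⟨ evalᴿ-- (toPoly p) (b *ₚ toPoly p′) ⟨
          evalᴿ (toPoly p -ₚ b *ₚ toPoly p′)
            ≈⟨ fromℤ-cong (eval-≡ (toPoly p -ₚ b *ₚ toPoly p′) (toPoly p″) h (+ m)) ⟩
          evalᴿ (toPoly p″)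
            ≈⟨ evalᴿ-toPoly p″ ⟩
          ℤ⟦ p″ ⟧ ∎

      -- The digits come from γ, the entries from induction in the basis 1, ρ, ρ². Only the initial
      -- vector is ever translated between ρ and s.
      β-formula : ∀ k → k ℕ.≤ 8 → β k ≋ (⟦ first k ⟧ , ⟦ second k ⟧ , ⟦ third k ⟧)
      β-formula zero _ = ≋-trans (proj₁ β-expansion)
        ( ≈.trans (≈.sym fromℤ-1) (solve 1 (λ ρ → con (+ 1) := con (+ 1) :+ con (+ 0) :* ρ :+ con (+ 0) :* (ρ :* ρ)) (λ {_} → ≈.refl) ρ)
        , solve 1 (λ ρ → :- ρ := con (+ 0) :+ con -[1+ 0 ] :* ρ :+ con (+ 0) :* (ρ :* ρ)) (λ {_} → ≈.refl) ρ
        , solve 1 (λ ρ → ρ :* ρ := con (+ 0) :+ con (+ 0) :* ρ :+ con (+ 1) :* (ρ :* ρ)) (λ {_} → ≈.refl) ρ)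
      β-formula (suc k) k<8 = ≋-trans (β≋γ (suc k)) (≋-trans (is-residue (γ-step k)) (≋-trans
          (residue-cong (digitsℤ k) (≋-trans (≋-sym (β≋γ k)) (β-formula k (ℕ.<⇒≤ k<8))))
          ( ⟦⟧-residue (proj₁ (digitsₚ k)) (second k) (first k) (first (suc k)) (proj₁ ok)
          , ⟦⟧-residue (proj₂ (digitsₚ k)) (third k) (first k) (second (suc k)) (proj₂ ok)
          , ≈.refl)))
        where ok = T-∧⁻ (isResidue (proj₁ (digitsₚ k)) (second k) (first k) (first (suc k))) (formulaStep-holds δ k<8)

-- The parity of a and the assembly.

open import Data.Integer.Base using (_+_; _-_; _*_; -_; _^_; _≤_)

-- The witness m = ⌊n/2⌋ ∸ 2 is a true difference because n ≥ 4.
halve : ∀ a → 4 ≤ a → ∃[ δ ] ∃[ m ] (a ≡ + toℕ {suc (suc zero)} δ + + (2 ℕ.+ m) * + 2 × a /ℕ 2 ≡ + (2 ℕ.+ m))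
halve (+ n) (+≤+ 4≤n) = n ℕ.mod 2 , n ℕ./ 2 ℕ.∸ 2 ,
  ≡.cong +_ (≡.trans (ℕ.DivMod.property (n ℕ.divMod 2)) (≡.cong (λ q → toℕ (n ℕ.mod 2) ℕ.+ q ℕ.* 2) n/2≡)) , ≡.cong +_ n/2≡
  where
  n/2≡ : n ℕ./ 2 ≡ 2 ℕ.+ (n ℕ./ 2 ℕ.∸ 2)
  n/2≡ = ≡.sym (ℕ.m+[n∸m]≡n (ℕ./-monoˡ-≤ 2 4≤n))

odd-indivisible : ∀ q → ¬ (2 ℕ.∣ 1 ℕ.+ q ℕ.* 2)
odd-indivisible q 2∣ = ℕ.<⇒≱ (ℕ.n<1+n 1) (ℕ.∣⇒≤ (ℕ.∣m+n∣m⇒∣n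
  (≡.subst (2 ℕ.∣_) (ℕ.+-comm 1 (q ℕ.* 2)) 2∣) (ℕ.n∣m*n q)))

theorem6p3 :
  ∀ {c ℓ₁ ℓ₂ ℓ₃ : Level} (ℝ : Reals c ℓ₁ ℓ₂ ℓ₃) →
  let module ℝ = Reals ℝ
      open JacobiPerron ℝ
  in
  (a : ℤ) → 4 ≤ a →
  (ρ : ℝ.Carrier) →
  evalMonic (- 1 ∷ - (a + 3) ∷ - a ∷ []) ρ ℝ.≈ ℝ.0# →
  ℝ.fromℤ (- 2) ℝ.< ρ → ρ ℝ.< ℝ.fromℤ (- 1) →
  let A = a /ℕ 2
      v = (ℝ.1# , ℝ.- ρ , ρ ℝ.* ρ)
      -- ⟦ p , q , r ⟧ is p + q ρ + r ρ²
      ⟦_,_,_⟧ : ℤ → ℤ → ℤ → ℝ.Carrier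
      ⟦_,_,_⟧ = quadratic ρ
  in
  (∃[ β ] IsExpansion v β) ×
  (∀ (β : ℕ → ℝ³) → IsExpansion v β →
    PeriodicWithLengths β 2 7 ×
    β 0 ≋ v ×
    β 1 ≋ ( ⟦ - 1 , - 1 , 0 ⟧
          , ⟦ - 1 , 0 , 1 ⟧
          , ℝ.1# ) ×
    β 2 ≋ ( ⟦ 1 , 2 , 1 ⟧
          , ⟦ a + 2 , a + 1 , 0 ⟧
          , ⟦ - 1 , - 1 , 0 ⟧ ) ×
    β 3 ≋ ( ⟦ a + 1 , a - 1 , - 1 ⟧
          , ⟦ - (a + 2) , - (2 * a + 3) , - (a + 1) ⟧
          , ⟦ 1 , 2 , 1 ⟧ ) ×
    β 4 ≋ ( ⟦ - (a + 2) , - (2 * a + 3) , - (a + 1) ⟧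
          , ⟦ - a , - (a - 3) , 2 ⟧
          , ⟦ a + 1 , a - 1 , - 1 ⟧ ) ×
    (2 ∣ a →
      β 5 ≋ ( ⟦ - a , - (a - 3) , 2 ⟧
            , ⟦ 2 * A ^ 2 + 4 * A + 1 , 4 * A ^ 2 + 5 * A - 1 , 2 * A ^ 2 + A - 1 ⟧
            , ⟦ - (a + 2) , - (2 * a + 3) , - (a + 1) ⟧ ) ×
      β 6 ≋ ( ⟦ 2 * A ^ 2 + 4 * A + 1 , 4 * A ^ 2 + 5 * A - 1 , 2 * A ^ 2 + A - 1 ⟧
            , ⟦ a - 2 , - 9 , - (a + 5) ⟧
            , ⟦ - a , - (a - 3) , 2 ⟧ ) ×
      β 7 ≋ ( ⟦ a - 2 , - 9 , - (a + 5) ⟧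
            , ⟦ - (2 * A ^ 2) - 6 * A - 1 , - (4 * A ^ 2 + 7 * A - 4) , - (2 * A ^ 2 + A - 3) ⟧
            , ⟦ 2 * A ^ 2 + 4 * A + 1 , 4 * A ^ 2 + 5 * A - 1 , 2 * A ^ 2 + A - 1 ⟧ )) ×
    (¬ (2 ∣ a) →
      β 5 ≋ ( ⟦ - a , - (a - 3) , 2 ⟧
            , ⟦ 2 * A ^ 2 + 5 * A + 2 , 4 * A ^ 2 + 7 * A , 2 * A ^ 2 + 2 * A - 1 ⟧
            , ⟦ - (a + 2) , - (2 * a + 3) , - (a + 1) ⟧ ) ×
      β 6 ≋ ( ⟦ 2 * A ^ 2 + 7 * A + 3 , 4 * A ^ 2 + 9 * A - 2 , 2 * A ^ 2 + 2 * A - 3 ⟧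
            , ⟦ a - 2 , - 9 , - (a + 5) ⟧
            , ⟦ - a , - (a - 3) , 2 ⟧ ) ×
      β 7 ≋ ( ⟦ a - 2 , - 9 , - (a + 5) ⟧
            , ⟦ - (2 * A ^ 2) - 9 * A - 4 , - (4 * A ^ 2 + 11 * A - 4) , - (2 * A ^ 2 + 2 * A - 5) ⟧
            , ⟦ 2 * A ^ 2 + 7 * A + 3 , 4 * A ^ 2 + 9 * A - 2 , 2 * A ^ 2 + 2 * A - 3 ⟧ )) ×
    β 8 ≋ ( ⟦ - (a ^ 2) - 5 , - (a ^ 2 - a + 14) , - 7 ⟧
          , ⟦ 7 , a ^ 2 + 7 * a + 26 , a ^ 2 + 6 * a + 14 ⟧
          , ⟦ a - 2 , - 9 , - (a + 5) ⟧ ))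
-- Abstracting `a /ℕ 2` lets both equations of `halve` be matched by `refl`; the claimed entries are
-- then literally the evaluated formulas.
theorem6p3 {c} {ℓ₁} {ℓ₂} {ℓ₃} ℝ a 4≤a ρ root _ ρ<-1 with a /ℕ 2 | halve a 4≤a
... | _ | 0F , m , refl , refl = (γ , γ-expansion) , λ β β-expansion →
    let formula = β-formula β β-expansion ; 1≈⟦1,0,0⟧ = ≈.trans (≈.sym (proj₁ (formula 0 z≤n))) (proj₁ (proj₁ β-expansion)) in
    β-lengths β β-expansion
  , proj₁ β-expansion
  -- The third entry is claimed as `1#`, while the formula gives 1 + 0 ρ + 0 ρ².
  , ≋-trans (formula 1 (s≤s z≤n)) (≈.refl , ≈.refl , 1≈⟦1,0,0⟧)
  , formula 2 (ℕ.m≤m+n 2 6)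
  , formula 3 (ℕ.m≤m+n 3 5)
  , formula 4 (ℕ.m≤m+n 4 4)
  , (λ _ → formula 5 (ℕ.m≤m+n 5 3) , formula 6 (ℕ.m≤m+n 6 2) , formula 7 (ℕ.m≤m+n 7 1))
  , (λ 2∤a → ⊥-elim (2∤a (ℕ.n∣m*n (2 ℕ.+ m))))
  , formula 8 ℕ.≤-refl
  where
  open CubicExpansion ℝ 0F m ρ
  open Cycle root ρ<-1
  open Expansions ℝ
  module ≈ = CommutativeRing (Reals.commutativeRing ℝ)
... | _ | 1F , m , refl , refl = (γ , γ-expansion) , λ β β-expansion →
    let formula = β-formula β β-expansion ; 1≈⟦1,0,0⟧ = ≈.trans (≈.sym (proj₁ (formula 0 z≤n))) (proj₁ (proj₁ β-expansion)) in
    β-lengths β β-expansion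
  , proj₁ β-expansion
  , ≋-trans (formula 1 (s≤s z≤n)) (≈.refl , ≈.refl , 1≈⟦1,0,0⟧)
  , formula 2 (ℕ.m≤m+n 2 6)
  , formula 3 (ℕ.m≤m+n 3 5)
  , formula 4 (ℕ.m≤m+n 4 4)
  , (λ 2∣a → ⊥-elim (odd-indivisible (2 ℕ.+ m) 2∣a))
  , (λ _ → formula 5 (ℕ.m≤m+n 5 3) , formula 6 (ℕ.m≤m+n 6 2) , formula 7 (ℕ.m≤m+n 7 1))
  , formula 8 ℕ.≤-refl
  where
  open CubicExpansion ℝ 1F m ρ
  open Cycle root ρ<-1
  open Expansions ℝ
  module ≈ = CommutativeRing (Reals.commutativeRing ℝ)
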